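{- Let $G$ be a bridgeless cubic graph (multiple edges and loops permitted) with colouring defect $\operatorname{df}(G)=3$. Then $G$ admits a Berge cover, that is, there exist at most five perfect matchings of $G$ whose union contains every edge of $G$.
   Context: The colouring defect $\operatorname{df}(G)$ of a bridgeless cubic graph $G$ is the minimum, over all collections $\{M_1,M_2,M_3\}$ of three (not necessarily distinct) perfect matchings of $G$, of the number of edges of $G$ belonging to none of $M_1,M_2,M_3$. -}

module Defs where

open import Data.Nat using (ℕ; _+_; _≤_)
open import Data.Fin using (Fin; _≟_)
open import Data.Fin.Subset using (Subset; _∈_; ⊤; ∁; ⁅_⁆; _∩_; _∪_; ⋃; ∣_∣)
open import Data.List using (List; length)
open import Data.List.Relation.Unary.All using (All)
open import Data.Product using (_×_; _,_; proj₁; proj₂; ∃-syntax)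
open import Data.Sum using (_⊎_)
open import Data.Vec using (tabulate)
open import Relation.Binary.Construct.Closure.ReflexiveTransitive using (Star)
open import Relation.Binary.PropositionalEquality using (_≡_)
open import Relation.Nullary using (¬_; does)

-- Finite undirected multigraphs.  The pair `ends e` is stored in an arbitrary
-- order that carries no meaning; distinct edges may have the same ends, and
-- `ends e ≡ (v , v)` makes e a loop.
record Multigraph : Set where
  field
    order : ℕ
    size  : ℕ
    ends  : Fin size → Fin order × Fin order

  Vertex : Set
  Vertex = Fin order

  Edge : Set
  Edge = Fin size

  EdgeSet : Set
  EdgeSet = Subset size

module _ (G : Multigraph) where
  open Multigraph G

  firstEndAt secondEndAt : Vertex → EdgeSet
  firstEndAt  v = tabulate λ e → does (proj₁ (ends e) ≟ v)
  secondEndAt v = tabulate λ e → does (proj₂ (ends e) ≟ v)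

  -- Degree of v in the spanning subgraph with edge set S; a loop counts twice.
  degreeIn : EdgeSet → Vertex → ℕ
  degreeIn S v = ∣ S ∩ firstEndAt v ∣ + ∣ S ∩ secondEndAt v ∣

  Cubic : Set
  Cubic = ∀ v → degreeIn ⊤ v ≡ 3

  AdjacentIn : EdgeSet → Vertex → Vertex → Set
  AdjacentIn S u v = ∃[ e ] e ∈ S × (ends e ≡ (u , v) ⊎ ends e ≡ (v , u))

  ConnectedIn : EdgeSet → Vertex → Vertex → Set
  ConnectedIn S = Star (AdjacentIn S)

  -- e is a bridge when its ends lie in different components of G − e.
  Bridge : Edge → Set
  Bridge e = ¬ ConnectedIn (∁ ⁅ e ⁆) (proj₁ (ends e)) (proj₂ (ends e))

  Bridgeless : Set
  Bridgeless = ∀ e → ¬ Bridge e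

  -- Perfect matchings are the edge sets of 1-regular spanning subgraphs.  Since
  -- a loop contributes 2 to the degree, no loop belongs to a perfect matching.
  PerfectMatching : EdgeSet → Set
  PerfectMatching M = ∀ v → degreeIn M v ≡ 1

  uncovered : EdgeSet → EdgeSet → EdgeSet → ℕ
  uncovered M₁ M₂ M₃ = ∣ ∁ (M₁ ∪ M₂ ∪ M₃) ∣

  -- df(G) = d, as a relation: d is attained and is a lower bound.  A function
  -- df would need a junk value for graphs without perfect matchings.
  ColouringDefect : ℕ → Set
  ColouringDefect d =
    (∃[ M₁ ] ∃[ M₂ ] ∃[ M₃ ]
      PerfectMatching M₁ × PerfectMatching M₂ × PerfectMatching M₃ ×
      uncovered M₁ M₂ M₃ ≡ d)
    ×
    (∀ M₁ M₂ M₃ →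
      PerfectMatching M₁ → PerfectMatching M₂ → PerfectMatching M₃ →
      d ≤ uncovered M₁ M₂ M₃)

  BergeCover : List EdgeSet → Set
  BergeCover Ms = length Ms ≤ 5 × All PerfectMatching Ms × (∀ e → e ∈ ⋃ Ms)

{-# OPTIONS --safe #-}

-- Three perfect matchings missing exactly three edges, with three minimal, leave
-- a hexagon in which missed and doubly covered edges alternate.  The edges off
-- the hexagon are properly 3-coloured by the matchings, and the six edges
-- leaving it have, in cyclic order, colours c a a b b c.  Kempe switches on this
-- colouring are a game on the colourings of six corners: at most three switches
-- lead, whichever way the Kempe chains run, either to colours that extend to the
-- hexagon (so three perfect matchings cover G) or to two colour classes whose
-- extensions to the hexagon contain all three missed edges (so they complete the
-- given matchings to five).
module Submission where

open import Data.Bool.Base using (Bool; true; false; if_then_else_; not; _∧_; _∨_)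
open import Data.Empty using (⊥; ⊥-elim)
open import Data.Fin using (Fin; zero; suc; _≟_; toℕ)
open import Data.Fin.Patterns
open import Data.Fin.Properties using (all?; any?)
open import Data.Fin.Subset
  using (Subset; inside; outside; _∈_; _∩_; _∪_; ⋃; ∁; ⁅_⁆; ⊤; ∣_∣)
open import Data.Fin.Subset.Properties using (x∈p∪q⁺; x∈∁p⇒x∉p; x∈⁅x⁆)
open import Data.List.Base using (List; []; _∷_)
open import Data.List.Relation.Unary.All using ([]; _∷_)
open import Data.List.Relation.Unary.Any using (Any; here; there; _─_)
open import Data.Nat.Base
  using (ℕ; zero; suc; _+_; _*_; _∸_; _≤_; z≤n; s≤s; >-nonZero)
import Data.Nat.Properties as ℕₚ
open import Data.Product using (_×_; _,_; proj₁; proj₂; ∃-syntax; Σ-syntax)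
open import Data.Sum using (_⊎_; inj₁; inj₂; [_,_]′)
open import Data.Vec.Base using ([]; _∷_; lookup; tabulate)
open import Data.Vec.Properties
  using (lookup∘tabulate; lookup⇒[]=; []=⇒lookup; lookup-map; lookup-zipWith; lookup-replicate)
open import Function.Base using (_∘_; id; case_of_)
open import Relation.Binary.Construct.Closure.ReflexiveTransitive using (ε; _◅_)
open import Relation.Binary.PropositionalEquality
open import Relation.Nullary
  using (Dec; does; yes; no; contradiction; _×-dec_; _⊎-dec_; _→-dec_; ¬?)
open import Relation.Nullary.Decidable using (toWitness; dec-true; dec-false)
open import Algebra.Properties.CommutativeSemigroup ℕₚ.+-commutativeSemigroup
  using () renaming (x∙yz≈y∙xz to +-swap)
open import Algebra.Properties.CommutativeMonoid.Sum ℕₚ.+-0-commutativeMonoid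
  using (sum; sum-cong-≗; ∑-distrib-+; sum-replicate-zero)
open import Defs
open ≡-Reasoning

-- Counting the ends of the three matchings at a vertex shows that it meets as many missed edges as
-- it has excess coverage. Minimality enters through one exchange: a missed edge parallel to a
-- multiply covered one could replace it in a matching. Bridgelessness serves only to exclude a
-- missed loop. Together they leave no triply covered edge, so missed and doubly covered edges have
-- equal degrees, at most 1. Their union is a union of alternating cycles, none of length two, and
-- three missed edges then lie on a single hexagon.
--
-- A Kempe chain from a corner must end at another corner, because every vertex off the hexagon
-- meets all three colours. A colouring of the corners that avoids a colour wins at once: that
-- colour class together with the three missed edges is a perfect matching. So only three distinct
-- colours `a`, `b`, `c` need play.
--
-- Colour classes are known only through their degrees. Chords of the hexagon therefore need no
-- separate case, and no chain is ever stored as a path.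

private
  variable
    n : ℕ

-- Finite sums, Kronecker deltas and indicator functions.

⟦_⟧ : Bool → ℕ
⟦ false ⟧ = 0
⟦ true ⟧  = 1

δ : Fin n → Fin n → ℕ
δ i j = ⟦ does (i ≟ j) ⟧

δ-refl : (i : Fin n) → δ i i ≡ 1
δ-refl i = cong ⟦_⟧ (dec-true (i ≟ i) refl)

δ-≢ : {i j : Fin n} → i ≢ j → δ i j ≡ 0
δ-≢ {i = i} {j} i≢j = cong ⟦_⟧ (dec-false (i ≟ j) i≢j)

δ-positive : {i j : Fin n} → 1 ≤ δ i j → i ≡ j
δ-positive {i = i} {j} p with i ≟ j
... | yes i≡j = i≡j
... | no _    = case p of λ ()

δ≤1 : (i j : Fin n) → δ i j ≤ 1
δ≤1 i j with i ≟ j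
... | yes _ = s≤s z≤n
... | no _  = z≤n

δ-injective : {m : ℕ} {f : Fin m → Fin n} → (∀ {i j} → f i ≡ f j → i ≡ j) →
  ∀ i j → δ (f i) (f j) ≡ δ i j
δ-injective {f = f} inj i j with i ≟ j
... | yes refl = δ-refl (f i)
... | no i≢j   = δ-≢ (i≢j ∘ inj)

positive⊎zero : ∀ m → 1 ≤ m ⊎ m ≡ 0
positive⊎zero zero    = inj₂ refl
positive⊎zero (suc m) = inj₁ (s≤s z≤n)

sum-zero : ∀ {n} {f : Fin n → ℕ} → (∀ i → f i ≡ 0) → sum f ≡ 0
sum-zero {n} f≡0 = trans (sum-cong-≗ f≡0) (sum-replicate-zero n)

positive-+ : ∀ m {n} → 1 ≤ m + n → 1 ≤ m ⊎ 1 ≤ n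
positive-+ zero    p = inj₂ p
positive-+ (suc m) p = inj₁ (s≤s z≤n)

sum-mono : {f g : Fin n → ℕ} → (∀ i → f i ≤ g i) → sum f ≤ sum g
sum-mono {zero}  f≤g = z≤n
sum-mono {suc n} f≤g = ℕₚ.+-mono-≤ (f≤g zero) (sum-mono (f≤g ∘ suc))

term≤sum : (f : Fin n → ℕ) (i : Fin n) → f i ≤ sum f
term≤sum f zero    = ℕₚ.m≤m+n _ _
term≤sum f (suc i) = ℕₚ.≤-trans (term≤sum (f ∘ suc) i) (ℕₚ.m≤n+m _ _)

sum-positive : {f : Fin n → ℕ} → 1 ≤ sum f → ∃[ i ] 1 ≤ f i
sum-positive {suc n} {f} p with positive⊎zero (f zero)
... | inj₁ q = zero , q
... | inj₂ q =
  let i , r = sum-positive {f = f ∘ suc} (subst (λ k → 1 ≤ k + sum (f ∘ suc)) q p)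
  in suc i , r

sum-δ* : (i : Fin n) (g : Fin n → ℕ) → sum (λ j → δ i j * g j) ≡ g i
sum-δ* {suc n} zero    g = trans
  (cong₂ _+_ (ℕₚ.+-identityʳ (g zero)) (sum-replicate-zero n))
  (ℕₚ.+-identityʳ (g zero))
sum-δ* {suc n} (suc i) g = sum-δ* i (g ∘ suc)

sum-δ : (i : Fin n) → sum (δ i) ≡ 1
sum-δ i = trans (sum-cong-≗ λ j → sym (ℕₚ.*-identityʳ (δ i j))) (sum-δ* i (λ _ → 1))

indicator : Subset n → Fin n → ℕ
indicator S i = ⟦ lookup S i ⟧

∣∣≡sum : (S : Subset n) → ∣ S ∣ ≡ sum (indicator S)
∣∣≡sum []            = refl
∣∣≡sum (inside  ∷ S) = cong suc (∣∣≡sum S)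
∣∣≡sum (outside ∷ S) = ∣∣≡sum S

∣∩tabulate∣ : (S : Subset n) (f : Fin n → Bool) →
  ∣ S ∩ tabulate f ∣ ≡ sum (λ i → indicator S i * ⟦ f i ⟧)
∣∩tabulate∣ []            f = refl
∣∩tabulate∣ (outside ∷ S) f = ∣∩tabulate∣ S (f ∘ suc)
∣∩tabulate∣ (inside  ∷ S) f with f zero
... | true  = cong suc (∣∩tabulate∣ S (f ∘ suc))
... | false = ∣∩tabulate∣ S (f ∘ suc)

indicator-positive : {S : Subset n} {i : Fin n} → 1 ≤ indicator S i → i ∈ S
indicator-positive {S = S} {i} p with lookup S i in eq
... | true  = lookup⇒[]= i S eq
... | false = case p of λ ()

-- Truncated: a unit is removed at i only where f i is positive.
infixl 6 _⊖_
_⊖_ : (Fin n → ℕ) → Fin n → Fin n → ℕ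
(f ⊖ i) j = f j ∸ δ i j

⊖-split : (f : Fin n → ℕ) {i : Fin n} → 1 ≤ f i → ∀ j → f j ≡ δ i j + (f ⊖ i) j
⊖-split f {i} p j with i ≟ j
... | yes refl = sym (ℕₚ.m+[n∸m]≡n p)
... | no _     = refl

⊖≤ : (f : Fin n → ℕ) (i j : Fin n) → (f ⊖ i) j ≤ f j
⊖≤ f i j = ℕₚ.m∸n≤m (f j) (δ i j)

sum-⊖ : (f : Fin n → ℕ) {i : Fin n} → 1 ≤ f i → sum f ≡ suc (sum (f ⊖ i))
sum-⊖ f {i} p = trans (sum-cong-≗ (⊖-split f p))
  (trans (∑-distrib-+ (δ i) (f ⊖ i)) (cong (_+ sum (f ⊖ i)) (sum-δ i)))

-- Degrees of edge multisets, and perfect matchings as weights of constant degree 1.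

module Degrees (G : Multigraph) where
  open Multigraph G

  inc : Edge → Vertex → ℕ
  inc e v = δ (proj₁ (ends e)) v + δ (proj₂ (ends e)) v

  -- Multisets of edges: unlike for subsets, degrees add up without any
  -- disjointness condition.
  Weight : Set
  Weight = Edge → ℕ

  degree : Weight → Vertex → ℕ
  degree f v = sum (λ e → f e * inc e v)

  degreeIn≡degree : ∀ S v → degreeIn G S v ≡ degree (indicator S) v
  degreeIn≡degree S v = trans
    (cong₂ _+_ (∣∩tabulate∣ S (λ e → does (proj₁ (ends e) ≟ v)))
               (∣∩tabulate∣ S (λ e → does (proj₂ (ends e) ≟ v))))
    (trans (sym (∑-distrib-+ (λ e → indicator S e * δ (proj₁ (ends e)) v)
                             (λ e → indicator S e * δ (proj₂ (ends e)) v)))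
      (sum-cong-≗ λ e → sym (ℕₚ.*-distribˡ-+ (indicator S e) _ _)))

  degree-cong : ∀ {f g} → f ≗ g → ∀ v → degree f v ≡ degree g v
  degree-cong f≗g v = sum-cong-≗ λ e → cong (_* inc e v) (f≗g e)

  degree-mono : ∀ {f g} → (∀ e → f e ≤ g e) → ∀ v → degree f v ≤ degree g v
  degree-mono f≤g v = sum-mono λ e → ℕₚ.*-monoˡ-≤ (inc e v) (f≤g e)

  degree-+ : ∀ f g v → degree (λ e → f e + g e) v ≡ degree f v + degree g v
  degree-+ f g v = trans (sum-cong-≗ λ e → ℕₚ.*-distribʳ-+ (inc e v) (f e) (g e))
    (∑-distrib-+ (λ e → f e * inc e v) (λ e → g e * inc e v))

  degree-δ* : ∀ a (g : Weight) v → degree (λ e → δ a e * g e) v ≡ g a * inc a v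
  degree-δ* a g v = trans (sum-cong-≗ {x = λ e → δ a e * g e * inc e v} λ e → ℕₚ.*-assoc (δ a e) (g e) (inc e v))
    (sum-δ* a (λ e → g e * inc e v))

  degree-δ : ∀ a v → degree (δ a) v ≡ inc a v
  degree-δ a v = sum-δ* a (λ e → inc e v)

  degree-δ+ : ∀ a f v → degree (λ e → δ a e + f e) v ≡ inc a v + degree f v
  degree-δ+ a f v = trans (degree-+ (δ a) f v) (cong (_+ degree f v) (degree-δ a v))

  degree-⊖ : ∀ f {a} → 1 ≤ f a → ∀ v → degree f v ≡ inc a v + degree (f ⊖ a) v
  degree-⊖ f {a} p v = trans (degree-cong (⊖-split f p) v) (degree-δ+ a (f ⊖ a) v)

  inc≤degree : ∀ f {a} → 1 ≤ f a → ∀ v → inc a v ≤ degree f v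
  inc≤degree f p v = subst (_ ≤_) (sym (degree-⊖ f p v)) (ℕₚ.m≤m+n _ _)

  positive-* : ∀ {m n} → 1 ≤ m * n → 1 ≤ m × 1 ≤ n
  positive-* {suc m} {suc n} _ = s≤s z≤n , s≤s z≤n
  positive-* {suc m} {zero}  p rewrite ℕₚ.*-zeroʳ m = case p of λ ()

  degree-positive : ∀ f {v} → 1 ≤ degree f v → ∃[ e ] (1 ≤ f e × 1 ≤ inc e v)
  degree-positive f p = let e , q = sum-positive p in e , positive-* q

  -- Stated through incidence numbers so that the stored order of the ends disappears, loops are the
  -- case of equal vertices, and parallel edges contribute equally to every degree.
  record Joins (e : Edge) (u w : Vertex) : Set where
    constructor joins
    field incidence : ∀ v → inc e v ≡ δ u v + δ w v
  open Joins public

  Joins-sym : ∀ {e u w} → Joins e u w → Joins e w u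
  Joins-sym {u = u} {w} j = joins λ v → trans (incidence j v) (ℕₚ.+-comm (δ u v) (δ w v))

  joins-ends : ∀ e → Joins e (proj₁ (ends e)) (proj₂ (ends e))
  joins-ends e = joins λ v → refl

  other-end : ∀ {e u} → 1 ≤ inc e u → ∃[ w ] Joins e u w
  other-end {e} {u} p with proj₁ (ends e) ≟ u | proj₂ (ends e) ≟ u
  ... | yes refl | _        = proj₂ (ends e) , joins-ends e
  ... | no _     | yes refl = proj₁ (ends e) , Joins-sym (joins-ends e)
  ... | no _     | no _     = case p of λ ()

  Joins-left : ∀ {e u w} → Joins e u w → 1 ≤ inc e u
  Joins-left {u = u} {w} j rewrite incidence j u | δ-refl u = s≤s z≤n

  Joins-right : ∀ {e u w} → Joins e u w → 1 ≤ inc e w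
  Joins-right = Joins-left ∘ Joins-sym

  loop-free : ∀ {e u w} → inc e u ≤ 1 → Joins e u w → u ≢ w
  loop-free {e} {u} p j refl rewrite incidence j u | δ-refl u = case p of λ { (s≤s ()) }

  -- Degree 1 at an end of e forces f e ≤ 1.
  perfectMatching-of-weight : ∀ f → (∀ v → degree f v ≡ 1) →
    ∃[ S ] (PerfectMatching G S × (∀ e → indicator S e ≡ f e))
  perfectMatching-of-weight f regular = S , perfect , same
    where
    S : EdgeSet
    S = tabulate λ e → does (1 ℕₚ.≤? f e)

    bounded : ∀ e → f e ≤ 1
    bounded e = ℕₚ.≤-trans (ℕₚ.m≤m*n (f e) (inc e u) {{>-nonZero (Joins-left (joins-ends e))}})
        (ℕₚ.≤-trans (term≤sum (λ e′ → f e′ * inc e′ u) e) (ℕₚ.≤-reflexive (regular u)))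
      where
      u = proj₁ (ends e)

    same : ∀ e → indicator S e ≡ f e
    same e rewrite lookup∘tabulate (λ e → does (1 ℕₚ.≤? f e)) e with f e | bounded e
    ... | zero  | _       = refl
    ... | suc _ | s≤s z≤n = refl

    perfect : PerfectMatching G S
    perfect v = trans (degreeIn≡degree S v) (trans (degree-cong same v) (regular v))

-- Kempe chains.

module Kempe (G : Multigraph) where
  open Multigraph G
  open Degrees G

  -- The effect of exchanging `S` and `S′` along the chain that starts at `x` and ends at `y`. The
  -- chain itself is forgotten: the degrees trade places at its two ends and stay put elsewhere, and
  -- `together` says that no edge is lost.
  record Switch (S S′ : Weight) (x : Vertex) : Set where
    field
      R R′     : Weight
      y        : Vertex
      y≢x      : y ≢ x
      odd      : degree S y + degree S′ y ≡ 1
      at-x     : degree R x ≡ degree S′ x × degree R′ x ≡ degree S x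
      at-y     : degree R y ≡ degree S′ y × degree R′ y ≡ degree S y
      kept     : ∀ {v} → v ≢ x → v ≢ y → degree R v ≡ degree S v × degree R′ v ≡ degree S′ v
      together : ∀ e → R e + R′ e ≡ S e + S′ e

  -- Peel off the edge e = xz of S and continue along S′ from z.
  kempe : ∀ n S S′ → sum S + sum S′ ≡ n →
    (∀ v → degree S v ≤ 1) → (∀ v → degree S′ v ≤ 1) →
    ∀ x → degree S x ≡ 1 → degree S′ x ≡ 0 → Switch S S′ x
  kempe n S S′ size S≤1 S′≤1 x Sx S′x
    with e , e∈S , e∋x ← degree-positive S (ℕₚ.≤-reflexive (sym Sx))
    with z , e-xz ← other-end e∋x
    = by-end n size (positive⊎zero (degree S′ z))
    where
    x≢z : x ≢ z
    x≢z = loop-free (ℕₚ.≤-trans (inc≤degree S e∈S x) (S≤1 x)) e-xz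

    S⁻ : Weight
    S⁻ = S ⊖ e

    S-split : ∀ v → degree S v ≡ δ x v + δ z v + degree S⁻ v
    S-split v = trans (degree-⊖ S e∈S v) (cong (_+ degree S⁻ v) (incidence e-xz v))

    S⁻≤S : ∀ v → degree S⁻ v ≤ degree S v
    S⁻≤S = degree-mono (⊖≤ S e)

    S⁻x : degree S⁻ x ≡ 0
    S⁻x = ℕₚ.suc-injective (trans (sym
      (trans (S-split x) (cong₂ (λ a b → a + b + degree S⁻ x) (δ-refl x) (δ-≢ (x≢z ∘ sym))))) Sx)

    Sz : degree S z ≡ 1
    Sz = ℕₚ.≤-antisym (S≤1 z) (ℕₚ.≤-trans (Joins-right e-xz) (inc≤degree S e∈S z))

    S⁻z : degree S⁻ z ≡ 0
    S⁻z = ℕₚ.suc-injective (trans (sym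
      (trans (S-split z) (cong₂ (λ a b → a + b + degree S⁻ z) (δ-≢ x≢z) (δ-refl z)))) Sz)

    S⁻-other : ∀ {v} → v ≢ x → v ≢ z → degree S⁻ v ≡ degree S v
    S⁻-other {v} v≢x v≢z = sym (trans (S-split v)
      (cong₂ (λ a b → a + b + degree S⁻ v) (δ-≢ (v≢x ∘ sym)) (δ-≢ (v≢z ∘ sym))))

    add : Weight → Weight
    add f a = δ e a + f a

    add-x : ∀ f → degree f x ≡ 0 → degree (add f) x ≡ 1
    add-x f fx = begin
      degree (add f) x             ≡⟨ degree-δ+ e f x ⟩
      inc e x + degree f x         ≡⟨ cong₂ _+_ (incidence e-xz x) fx ⟩
      δ x x + δ z x + 0            ≡⟨ cong₂ (λ a b → a + b + 0) (δ-refl x) (δ-≢ (x≢z ∘ sym)) ⟩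
      1                            ∎

    add-z : ∀ f → degree f z ≡ 0 → degree (add f) z ≡ 1
    add-z f fz = begin
      degree (add f) z             ≡⟨ degree-δ+ e f z ⟩
      inc e z + degree f z         ≡⟨ cong₂ _+_ (incidence e-xz z) fz ⟩
      δ x z + δ z z + 0            ≡⟨ cong₂ (λ a b → a + b + 0) (δ-≢ x≢z) (δ-refl z) ⟩
      1                            ∎

    add-other : ∀ f {v} → v ≢ x → v ≢ z → degree (add f) v ≡ degree f v
    add-other f {v} v≢x v≢z = begin
      degree (add f) v             ≡⟨ degree-δ+ e f v ⟩
      inc e v + degree f v         ≡⟨ cong (_+ degree f v) (incidence e-xz v) ⟩
      δ x v + δ z v + degree f v   ≡⟨ cong₂ (λ a b → a + b + degree f v) (δ-≢ (v≢x ∘ sym)) (δ-≢ (v≢z ∘ sym)) ⟩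
      degree f v                   ∎

    by-end : ∀ n → sum S + sum S′ ≡ n → 1 ≤ degree S′ z ⊎ degree S′ z ≡ 0 → Switch S S′ x
    by-end n size (inj₂ S′z) = record
      { R = S⁻ ; R′ = add S′ ; y = z
      ; y≢x = x≢z ∘ sym
      ; odd = cong₂ _+_ Sz S′z
      ; at-x = trans S⁻x (sym S′x) , trans (add-x S′ S′x) (sym Sx)
      ; at-y = trans S⁻z (sym S′z) , trans (add-z S′ S′z) (sym Sz)
      ; kept = λ v≢x v≢z → S⁻-other v≢x v≢z , add-other S′ v≢x v≢z
      ; together = λ a → trans (move (S⁻ a) (δ e a) (S′ a)) (cong (_+ S′ a) (sym (⊖-split S e∈S a)))
      }
      where
      move : ∀ p q r → p + (q + r) ≡ q + p + r
      move p q r = trans (sym (ℕₚ.+-assoc p q r)) (cong (_+ r) (ℕₚ.+-comm p q))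
    -- Impossible: `e` itself counts in `sum S`, so the measure is positive.
    by-end zero size (inj₁ S′z≥1) = case trans (sym size) (cong (_+ sum S′) (sum-⊖ S e∈S)) of λ ()
    by-end (suc n) size (inj₁ S′z≥1) = record
      -- `rest` has turned `S′` into its `R` and `S⁻` into its `R′`; the peeled edge `e` crosses
      -- over to the second class.
      { R = R′ ; R′ = add R ; y = y
      ; y≢x = y≢x′
      ; odd = trans (ℕₚ.+-comm (degree S y) (degree S′ y))
                    (trans (cong (degree S′ y +_) (sym S⁻y)) odd)
      ; at-x = trans R′x (sym S′x) , trans (add-x R Rx) (sym Sx)
      ; at-y = proj₂ at-y , trans (add-other R y≢x′ y≢x) (trans (proj₁ at-y) S⁻y)
      ; kept = kept′
      ; together = λ a → begin
          R′ a + (δ e a + R a)   ≡⟨ move (R′ a) (δ e a) (R a) ⟩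
          δ e a + (R a + R′ a)   ≡⟨ cong (δ e a +_) (together a) ⟩
          δ e a + (S′ a + S⁻ a)  ≡⟨ sym (move′ (δ e a) (S⁻ a) (S′ a)) ⟩
          δ e a + S⁻ a + S′ a    ≡⟨ cong (_+ S′ a) (sym (⊖-split S e∈S a)) ⟩
          S a + S′ a             ∎
      }
      where
      move : ∀ p q r → p + (q + r) ≡ q + (r + p)
      move p q r = trans (ℕₚ.+-comm p (q + r)) (ℕₚ.+-assoc q r p)
      move′ : ∀ p q r → p + q + r ≡ p + (r + q)
      move′ p q r = trans (ℕₚ.+-assoc p q r) (cong (p +_) (ℕₚ.+-comm q r))

      S′z : degree S′ z ≡ 1
      S′z = ℕₚ.≤-antisym (S′≤1 z) S′z≥1

      rest : Switch S′ S⁻ z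
      rest = kempe n S′ S⁻
        (trans (ℕₚ.+-comm (sum S′) (sum S⁻))
          (ℕₚ.suc-injective (trans (sym (cong (_+ sum S′) (sum-⊖ S e∈S))) size)))
        S′≤1 (λ v → ℕₚ.≤-trans (S⁻≤S v) (S≤1 v)) z S′z S⁻z
      open Switch rest

      -- The chain cannot return to `x`: once `e` is gone, `x` has degree 0 in both classes, while
      -- `odd` requires total degree 1 at `y`.
      y≢x′ : y ≢ x
      y≢x′ y≡x = case trans (sym (subst (λ v → degree S′ v + degree S⁻ v ≡ 1) y≡x odd))
                            (cong₂ _+_ S′x S⁻x) of λ ()

      S⁻y : degree S⁻ y ≡ degree S y
      S⁻y = S⁻-other y≢x′ y≢x

      R′x : degree R′ x ≡ 0
      R′x = trans (proj₂ (kept x≢z (y≢x′ ∘ sym))) S⁻x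

      Rx : degree R x ≡ 0
      Rx = trans (proj₁ (kept x≢z (y≢x′ ∘ sym))) S′x

      -- At the inner vertex `z` the recursive switch moves the `S′`-edge into the first class, and
      -- `e` replaces it in the second, so both degrees are still 1.
      kept′ : ∀ {v} → v ≢ x → v ≢ y → degree R′ v ≡ degree S v × degree (add R) v ≡ degree S′ v
      kept′ {v} v≢x v≢y with v ≟ z
      ... | yes refl = trans (proj₂ at-x) (trans S′z (sym Sz)) ,
                       trans (add-z R (trans (proj₁ at-x) S⁻z)) (sym S′z)
      ... | no v≢z   = trans (proj₂ (kept v≢z v≢y)) (S⁻-other v≢x v≢z) ,
                       trans (add-other R v≢x v≢z) (proj₁ (kept v≢z v≢y))

-- The game on colourings of the six corners.

Corner Colour : Set
Corner = Fin 6
Colour = Fin 3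

Colouring : Set
Colouring = Corner → Colour

next : Corner → Corner
next 0F = 1F
next 1F = 2F
next 2F = 3F
next 3F = 4F
next 4F = 5F
next 5F = 0F

-- X selects edges of the hexagon, edge k joining the corners k and next k.
Completes : Colouring → Colour → (Corner → ℕ) → Set
Completes c i X = ∀ m → δ (c m) i + sum (λ k → X k * (δ k m + δ (next k) m)) ≡ 1

-- Going round the hexagon from edge 0, the corners determine X.
fill : Colouring → Colour → Fin 2 → Corner → ℕ
fill c i b = lookup (x₀ ∷ x₁ ∷ x₂ ∷ x₃ ∷ x₄ ∷ x₅ ∷ [])
  where
  -- Truncation is harmless: where the subtraction would go below zero, `Completes` fails at that
  -- corner. The closing condition at corner 0 is likewise left to `Completes`.
  step : Corner → ℕ → ℕ
  step k x = 1 ∸ δ (c k) i ∸ x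
  x₀ = toℕ b
  x₁ = step 1F x₀
  x₂ = step 2F x₁
  x₃ = step 3F x₂
  x₄ = step 4F x₃
  x₅ = step 5F x₄

Extendable : Colouring → Set
Extendable c = ∃[ b₀ ] ∃[ b₁ ] ∃[ b₂ ] let X = fill c 0F b₀ ; Y = fill c 1F b₁ ; Z = fill c 2F b₂ in
  (Completes c 0F X × Completes c 1F Y × Completes c 2F Z) × (∀ k → 1 ≤ X k + (Y k + Z k))

-- The missed edges of the hexagon are the edges 0, 2 and 4.
Complementary : Colouring → Set
Complementary c = ∃[ i ] ∃[ j ] ∃[ a ] ∃[ b ] let X = fill c i a ; Y = fill c j b in
  (Completes c i X × Completes c j Y) × 1 ≤ X 0F + Y 0F × 1 ≤ X 2F + Y 2F × 1 ≤ X 4F + Y 4F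

swapColour : Colour → Colour → Colour → Colour
swapColour i j a = if does (a ≟ i) then j else if does (a ≟ j) then i else a

switch : Colouring → Corner → Corner → Corner → Colouring
switch c k p l m = if does (m ≟ k) ∨ does (m ≟ l) then swapColour (c k) (c p) (c m) else c m

-- The entry (k , p) switches the Kempe chain leaving corner k in the colours of
-- the corners k and p; its other end l is out of our control.
Wins : List (Corner × Corner) → Colouring → Set
Wins ms c = (Extendable c ⊎ Complementary c) ⊎ Move ms
  where
  Move : List (Corner × Corner) → Set
  Move []             = ⊥
  Move ((k , p) ∷ ms) = c k ≢ c p ×
    (∀ l → l ≢ k → c l ≡ c k ⊎ c l ≡ c p → Wins ms (switch c k p l))

completes? : ∀ c i X → Dec (Completes c i X)
completes? c i X = all? λ m → _ ℕₚ.≟ 1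

extendable? : ∀ c → Dec (Extendable c)
extendable? c = any? λ b₀ → any? λ b₁ → any? λ b₂ →
  (completes? c 0F (fill c 0F b₀) ×-dec completes? c 1F (fill c 1F b₁)
    ×-dec completes? c 2F (fill c 2F b₂))
  ×-dec (all? λ k → 1 ℕₚ.≤? _)

complementary? : ∀ c → Dec (Complementary c)
complementary? c = any? λ i → any? λ j → any? λ a → any? λ b →
  (completes? c i (fill c i a) ×-dec completes? c j (fill c j b)) ×-dec 1 ℕₚ.≤? _ ×-dec 1 ℕₚ.≤? _ ×-dec 1 ℕₚ.≤? _

wins? : ∀ ms c → Dec (Wins ms c)
wins? []             c = (extendable? c ⊎-dec complementary? c) ⊎-dec no λ ()
wins? ((k , p) ∷ ms) c = (extendable? c ⊎-dec complementary? c) ⊎-dec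
  (¬? (c k ≟ c p) ×-dec all? λ l →
    ¬? (l ≟ k) →-dec ((c l ≟ c k ⊎-dec c l ≟ c p) →-dec wins? ms (switch c k p l)))

-- Found by exhaustive search.
plan : List (Corner × Corner)
plan = (1F , 3F) ∷ (0F , 2F) ∷ (0F , 1F) ∷ []

-- `a`, `b` and `c` belong to the hexagon edges 1, 3 and 5, each giving its colour to both of its
-- ends; edge 5 joins the corners 5 and 0, so `c` stands first and last.
start : Colour → Colour → Colour → Colouring
start a b c = lookup (c ∷ a ∷ a ∷ b ∷ b ∷ c ∷ [])

-- If two of `a`, `b`, `c` agree, some colour is at no corner and `start` is already
-- `Complementary`. For distinct colours the moves are played out against every possible end of each
-- chain, by evaluating the decision procedure.
start-wins : ∀ a b c → Wins plan (start a b c)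
start-wins = toWitness {a? = all? λ a → all? λ b → all? λ c → wins? plan (start a b c)} _

-- Exchanging two colours is an involution, so it can be carried from the class index over to the
-- colour of a corner.
δ-swapColour : ∀ i j a b → δ a (swapColour i j b) ≡ δ (swapColour i j a) b
δ-swapColour = toWitness {a? = all? λ i → all? λ j → all? λ a → all? λ b →
  δ a (swapColour i j b) ℕₚ.≟ δ (swapColour i j a) b} _

∈-⋃ : ∀ {n} {e : Fin n} {Ms} → Any (e ∈_) Ms → e ∈ ⋃ Ms
∈-⋃ (here p)  = x∈p∪q⁺ (inj₁ p)
∈-⋃ (there p) = x∈p∪q⁺ (inj₂ (∈-⋃ p))

-- From moves and wins of the game to edge sets of the graph.

module Hexagon (G : Multigraph) (v : Corner → Multigraph.Vertex G) (h : Corner → Multigraph.Edge G)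
  (v-injective : ∀ {k l} → v k ≡ v l → k ≡ l)
  (h-joins : ∀ k → Degrees.Joins G (h k) (v k) (v (next k))) where
  open Multigraph G
  open Degrees G
  open Kempe G

  record Realises (c : Colouring) : Set where
    field
      class  : Colour → Weight
      corner : ∀ i m → degree (class i) (v m) ≡ δ (c m) i
      off    : ∀ i {x} → (∀ k → v k ≢ x) → degree (class i) x ≡ 1
      cover  : ∀ e → (∃[ k ] h k ≡ e) ⊎ (∃[ i ] 1 ≤ class i e)

    class≤1 : ∀ i x → degree (class i) x ≤ 1
    class≤1 i x with any? (λ k → v k ≟ x)
    ... | yes (k , refl) = ℕₚ.≤-trans (ℕₚ.≤-reflexive (corner i k)) (δ≤1 (c k) i)
    ... | no none        = ℕₚ.≤-reflexive (off i λ k p → none (k , p))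

  switch-along : ∀ {c} (real : Realises c) k p → c k ≢ c p → let open Realises real in
    Switch (class (c k)) (class (c p)) (v k) →
    ∃[ l ] (l ≢ k × (c l ≡ c k ⊎ c l ≡ c p) × Realises (switch c k p l))
  switch-along {c} real k p i≢j chain = found (any? λ l → v l ≟ y)
    where
    open Realises real
    open Switch chain
    i j : Colour
    i = c k
    j = c p

    new : Colour → Weight
    new a = if does (a ≟ i) then R else if does (a ≟ j) then R′ else class a

    new-i : ∀ {e} → 1 ≤ R e → 1 ≤ new i e
    new-i q with i ≟ i
    ... | yes _  = q
    ... | no i≢i = contradiction refl i≢i

    new-j : ∀ {e} → 1 ≤ R′ e → 1 ≤ new j e
    new-j q with j ≟ i | j ≟ j
    ... | yes j≡i | _      = contradiction (sym j≡i) i≢j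
    ... | no _    | yes _  = q
    ... | no _    | no j≢j = contradiction refl j≢j

    new-kept : ∀ a {x} → x ≢ v k → x ≢ y → degree (new a) x ≡ degree (class a) x
    new-kept a x≢ x≢y with a ≟ i | a ≟ j
    ... | yes refl | _        = proj₁ (kept x≢ x≢y)
    ... | no _     | yes refl = proj₂ (kept x≢ x≢y)
    ... | no _     | no _     = refl

    new-swapped : ∀ a {x} → degree R x ≡ degree (class j) x × degree R′ x ≡ degree (class i) x →
      degree (new a) x ≡ degree (class (swapColour i j a)) x
    new-swapped a (p , q) with a ≟ i | a ≟ j
    ... | yes _ | _     = p
    ... | no _  | yes _ = q
    ... | no _  | no _  = refl

    new-cover : ∀ {a e} → 1 ≤ class a e → ∃[ b ] 1 ≤ new b e
    new-cover {a} {e} q with a ≟ i | a ≟ j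
    ... | yes refl | _ = [ (λ r → i , new-i r) , (λ r → j , new-j r) ]′
      (positive-+ (R e) (subst (1 ≤_) (sym (together e)) (ℕₚ.≤-trans q (ℕₚ.m≤m+n _ _))))
    ... | no _ | yes refl = [ (λ r → i , new-i r) , (λ r → j , new-j r) ]′
      (positive-+ (R e) (subst (1 ≤_) (sym (together e)) (ℕₚ.≤-trans q (ℕₚ.m≤n+m _ _))))
    ... | no a≢i | no a≢j = a , new-a
      where
      new-a : 1 ≤ new a e
      new-a with a ≟ i | a ≟ j
      ... | yes a≡i | _       = contradiction a≡i a≢i
      ... | no _    | yes a≡j = contradiction a≡j a≢j
      ... | no _    | no _    = q

    found : Dec (∃[ l ] v l ≡ y) →
      ∃[ l ] (l ≢ k × (c l ≡ i ⊎ c l ≡ j) × Realises (switch c k p l))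
    -- Off the hexagon both classes have degree 1, total 2, which contradicts `odd`; so the chain
    -- ends at a corner.
    found (no none) = case trans (sym odd)
      (cong₂ _+_ (off i λ l q → none (l , q)) (off j λ l q → none (l , q))) of λ ()
    found (yes (l , vl≡y)) = l , (λ { refl → y≢x (sym vl≡y) }) , colour , record
      { class  = new
      ; corner = new-corner
      ; off    = λ a x-off → trans (new-kept a (x-off k ∘ sym) (λ x≡y → x-off l (trans vl≡y (sym x≡y))))
                                (off a x-off)
      ; cover  = λ e → [ inj₁ , (λ (_ , q) → inj₂ (new-cover q)) ]′ (cover e)
      }
      where
      colour : c l ≡ i ⊎ c l ≡ j
      colour = [ inj₁ ∘ δ-positive , inj₂ ∘ δ-positive ]′ (positive-+ (δ (c l) i) (ℕₚ.≤-reflexive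
        (trans (sym odd) (trans (sym (cong (λ u → degree (class i) u + degree (class j) u) vl≡y))
          (cong₂ _+_ (corner i l) (corner j l))))))

      new-corner : ∀ a m → degree (new a) (v m) ≡ δ (switch c k p l m) a
      new-corner a m with m ≟ k | m ≟ l
      ... | yes refl | _        = trans (new-swapped a at-x)
        (trans (corner (swapColour i j a) m) (δ-swapColour i j (c m) a))
      ... | no _     | yes refl = trans
        (new-swapped a (subst (λ u → degree R u ≡ degree (class j) u × degree R′ u ≡ degree (class i) u)
          (sym vl≡y) at-y))
        (trans (corner (swapColour i j a) m) (δ-swapColour i j (c m) a))
      ... | no m≢k   | no m≢l   = trans
        (new-kept a (m≢k ∘ v-injective) (λ q → m≢l (v-injective (trans q (sym vl≡y))))) (corner a m)

  switch-realised : ∀ {c} → Realises c → ∀ k p → c k ≢ c p →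
    ∃[ l ] (l ≢ k × (c l ≡ c k ⊎ c l ≡ c p) × Realises (switch c k p l))
  switch-realised {c} real k p i≢j = switch-along real k p i≢j
    (kempe _ (class (c k)) (class (c p)) refl (class≤1 (c k)) (class≤1 (c p)) (v k)
      (trans (corner (c k) k) (δ-refl (c k))) (trans (corner (c p) k) (δ-≢ i≢j)))
    where open Realises real

  degree-scaled : ∀ x a u → degree (λ e → x * δ a e) u ≡ x * inc a u
  degree-scaled x a u = trans (degree-cong (λ e → ℕₚ.*-comm x (δ a e)) u) (degree-δ* a (λ _ → x) u)

  degree-combination : ∀ {n} (X : Fin n → ℕ) (a : Fin n → Edge) u →
    degree (λ e → sum (λ k → X k * δ (a k) e)) u ≡ sum (λ k → X k * inc (a k) u)
  degree-combination {zero}  X a u = sum-replicate-zero size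
  degree-combination {suc n} X a u = trans
    (degree-+ (λ e → X zero * δ (a zero) e) (λ e → sum (λ k → X (suc k) * δ (a (suc k)) e)) u)
    (cong₂ _+_ (degree-scaled (X zero) (a zero) u) (degree-combination (X ∘ suc) (a ∘ suc) u))

  record Extension (f : Weight) (X : Corner → ℕ) : Set where
    field
      matching : EdgeSet
      perfect  : PerfectMatching G matching
      ∋class   : ∀ {e} → 1 ≤ f e → e ∈ matching
      ∋hexagon : ∀ {k} → 1 ≤ X k → h k ∈ matching

  -- The class plus the chosen hexagon edges has degree 1 everywhere: at the corners by `Completes`,
  -- elsewhere because the class is already regular and the hexagon does not reach there. A weight
  -- of constant degree 1 is a perfect matching.
  extend : ∀ {c} (real : Realises c) i X → Completes c i X → Extension (Realises.class real i) X
  extend {c} real i X completes =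
    let S , perfect , same = perfectMatching-of-weight f regular in record
      { matching = S
      ; perfect  = perfect
      ; ∋class   = λ {e} p → indicator-positive (subst (1 ≤_) (sym (same e)) (ℕₚ.≤-trans p (ℕₚ.m≤m+n _ _)))
      ; ∋hexagon = λ {k} p → indicator-positive (subst (1 ≤_) (sym (same (h k)))
          (ℕₚ.≤-trans (ℕₚ.≤-trans
            (subst (1 ≤_) (sym (trans (cong (X k *_) (δ-refl (h k))) (ℕₚ.*-identityʳ (X k)))) p)
            (term≤sum (λ l → X l * δ (h l) (h k)) k)) (ℕₚ.m≤n+m _ (class i (h k)))))
      }
    where
    open Realises real
    added f : Weight
    added e = sum (λ k → X k * δ (h k) e)
    f e = class i e + added e

    degree-added : ∀ x → degree added x ≡ sum (λ k → X k * (δ (v k) x + δ (v (next k)) x))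
    degree-added x = trans (degree-combination X h x)
      (sum-cong-≗ λ k → cong (X k *_) (incidence (h-joins k) x))

    regular : ∀ x → degree f x ≡ 1
    regular x with any? (λ m → v m ≟ x)
    ... | yes (m , refl) = trans (degree-+ (class i) added (v m))
      (trans (cong₂ _+_ (corner i m) (trans (degree-added (v m))
        (sum-cong-≗ λ k → cong (X k *_)
          (cong₂ _+_ (δ-injective v-injective k m) (δ-injective v-injective (next k) m)))))
        (completes m))
    ... | no none = trans (degree-+ (class i) added x)
      (cong₂ _+_ (off i away) (trans (degree-added x)
        (sum-zero λ k → trans (cong (X k *_) (cong₂ _+_ (δ-≢ (away k)) (δ-≢ (away (next k)))))
          (ℕₚ.*-zeroʳ (X k)))))
      where
      away : ∀ k → v k ≢ x
      away k q = none (k , q)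

  module _ {M₁ M₂ M₃ : EdgeSet}
    (M₁-perfect : PerfectMatching G M₁) (M₂-perfect : PerfectMatching G M₂) (M₃-perfect : PerfectMatching G M₃)
    (covered : ∀ e → Any (e ∈_) (M₁ ∷ M₂ ∷ M₃ ∷ []) ⊎ (h 0F ≡ e ⊎ h 2F ≡ e ⊎ h 4F ≡ e)) where

    -- Three covering matchings would contradict colouring defect 3, but they are themselves a Berge
    -- cover and are returned as such.
    bergeCover-extendable : ∀ {c} → Realises c → Extendable c → ∃[ Ms ] BergeCover G Ms
    bergeCover-extendable {c} real (b₀ , b₁ , b₂ , (p , q , r) , total) =
      (matching E₀ ∷ matching E₁ ∷ matching E₂ ∷ []) , s≤s (s≤s (s≤s z≤n)) ,
      (perfect E₀ ∷ perfect E₁ ∷ perfect E₂ ∷ []) , λ e → ∈-⋃ ([ on-hexagon , off-hexagon ]′ (cover e))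
      where
      open Realises real
      open Extension
      E₀ = extend real 0F (fill c 0F b₀) p
      E₁ = extend real 1F (fill c 1F b₁) q
      E₂ = extend real 2F (fill c 2F b₂) r

      on-hexagon : ∀ {e} → ∃[ k ] h k ≡ e → Any (e ∈_) (matching E₀ ∷ matching E₁ ∷ matching E₂ ∷ [])
      on-hexagon (k , refl) = case positive-+ (fill c 0F b₀ k) (total k) of λ
        { (inj₁ s) → here (∋hexagon E₀ s)
        ; (inj₂ s) → there ([ here ∘ ∋hexagon E₁ , there ∘ here ∘ ∋hexagon E₂ ]′ (positive-+ (fill c 1F b₁ k) s)) }

      off-hexagon : ∀ {e} → ∃[ i ] 1 ≤ class i e → Any (e ∈_) (matching E₀ ∷ matching E₁ ∷ matching E₂ ∷ [])
      off-hexagon (0F , s) = here (∋class E₀ s)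
      off-hexagon (1F , s) = there (here (∋class E₁ s))
      off-hexagon (2F , s) = there (there (here (∋class E₂ s)))

    -- The two extended classes supply the three missed edges and the given matchings cover all
    -- others; this is where the bound five is attained.
    bergeCover-complementary : ∀ {c} → Realises c → Complementary c → ∃[ Ms ] BergeCover G Ms
    bergeCover-complementary {c} real (i , j , a , b , (p , q) , cover₀ , cover₂ , cover₄) =
      (matching E₄ ∷ matching E₅ ∷ M₁ ∷ M₂ ∷ M₃ ∷ []) , ℕₚ.≤-refl ,
      (perfect E₄ ∷ perfect E₅ ∷ M₁-perfect ∷ M₂-perfect ∷ M₃-perfect ∷ []) ,
      λ e → ∈-⋃ (case covered e of λ
        { (inj₁ s)                  → there (there s)
        ; (inj₂ (inj₁ refl))        → by 0F cover₀
        ; (inj₂ (inj₂ (inj₁ refl))) → by 2F cover₂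
        ; (inj₂ (inj₂ (inj₂ refl))) → by 4F cover₄ })
      where
      open Extension
      E₄ = extend real i (fill c i a) p
      E₅ = extend real j (fill c j b) q

      by : ∀ k → 1 ≤ fill c i a k + fill c j b k → Any (h k ∈_) (matching E₄ ∷ matching E₅ ∷ M₁ ∷ M₂ ∷ M₃ ∷ [])
      by k s = [ here ∘ ∋hexagon E₄ , there ∘ here ∘ ∋hexagon E₅ ]′ (positive-+ (fill c i a k) s)

    bergeCover-of-win : ∀ ms {c} → Wins ms c → Realises c → ∃[ Ms ] BergeCover G Ms
    bergeCover-of-win ms (inj₁ (inj₁ ext))  real = bergeCover-extendable real ext
    bergeCover-of-win ms (inj₁ (inj₂ comp)) real = bergeCover-complementary real comp
    bergeCover-of-win ((k , p) ∷ ms) (inj₂ (k≢p , wins)) real =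
      let l , l≢k , colour , real′ = switch-realised real k p k≢p
      in bergeCover-of-win ms (wins l l≢k colour) real′

-- Lists of vertices counted with multiplicity.

occurrences : List (Fin n) → Fin n → ℕ
occurrences []      v = 0
occurrences (x ∷ L) v = δ x v + occurrences L v

occurs : (L : List (Fin n)) {v : Fin n} → 1 ≤ occurrences L v → Any (v ≡_) L
occurs (x ∷ L) {v} p = [ here ∘ sym ∘ δ-positive , there ∘ occurs L ]′ (positive-+ (δ x v) p)

occurrences-remove : (L : List (Fin n)) {y : Fin n} (p : Any (y ≡_) L) →
  ∀ v → occurrences L v ≡ δ y v + occurrences (L ─ p) v
occurrences-remove (x ∷ L) (here refl) v = refl
occurrences-remove (x ∷ L) {y} (there p) v =
  trans (cong (δ x v +_) (occurrences-remove L p v)) (+-swap (δ x v) (δ y v) _)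

injective-of-sum≤1 : ∀ {k} (f : Fin k → Fin n) → (∀ v → sum (λ i → δ (f i) v) ≤ 1) →
  ∀ {i j} → f i ≡ f j → i ≡ j
injective-of-sum≤1 f simple {i} {j} fi≡fj with i ≟ j
... | yes i≡j = i≡j
... | no i≢j  = contradiction
  (ℕₚ.≤-trans (subst (_≤ sum (λ m → δ (f m) (f i)))
    (trans (∑-distrib-+ (δ i) (δ j)) (cong₂ _+_ (sum-δ i) (sum-δ j))) (sum-mono both)) (simple (f i)))
  (λ { (s≤s ()) })
  where
  -- Both indices are sent to `f i`, so the sum at that vertex would be at least 2.
  both : ∀ m → δ i m + δ j m ≤ δ (f m) (f i)
  both m with i ≟ m | j ≟ m
  ... | yes refl | yes refl = contradiction refl i≢j
  ... | yes refl | no _     = ℕₚ.≤-reflexive (sym (δ-refl (f m)))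
  ... | no _     | yes refl = ℕₚ.≤-reflexive (sym (trans (cong (δ (f m)) fi≡fj) (δ-refl (f m))))
  ... | no _     | no _     = z≤n

-- How often three matchings cover one edge.

none all³ twice : Bool → Bool → Bool → Bool
none a b c  = not (a ∨ (b ∨ c))
twice a b c = (a ∧ b) ∨ ((a ∧ c) ∨ (b ∧ c))
all³ a b c  = a ∧ (b ∧ c)

-- `twice` means at least twice, so a triply covered edge counts in both `twice` and `all³`.
-- Together they give the multiplicity minus one on covered edges, and `none` makes up for the
-- missed ones.
balance : ∀ a b c → ⟦ a ⟧ + (⟦ b ⟧ + (⟦ c ⟧ + ⟦ none a b c ⟧)) ≡ 1 + (⟦ twice a b c ⟧ + ⟦ all³ a b c ⟧)
balance false false false = refl
balance false false true  = refl
balance false true  false = refl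
balance false true  true  = refl
balance true  false false = refl
balance true  false true  = refl
balance true  true  false = refl
balance true  true  true  = refl

none-swap : ∀ a b c → none a b c ≡ none b a c
none-swap false false c = refl
none-swap false true  c = refl
none-swap true  false c = refl
none-swap true  true  c = refl

none+twice≤1 : ∀ a b c → ⟦ none a b c ⟧ + ⟦ twice a b c ⟧ ≤ 1
none+twice≤1 false false false = s≤s z≤n
none+twice≤1 false false true  = z≤n
none+twice≤1 false true  false = z≤n
none+twice≤1 false true  true  = s≤s z≤n
none+twice≤1 true  false false = z≤n
none+twice≤1 true  false true  = s≤s z≤n
none+twice≤1 true  true  c     = s≤s z≤n

all³≤twice : ∀ a b c → ⟦ all³ a b c ⟧ ≤ ⟦ twice a b c ⟧
all³≤twice false b     c     = z≤n
all³≤twice true  false c     = z≤n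
all³≤twice true  true  false = z≤n
all³≤twice true  true  true  = s≤s z≤n

none-antitone : ∀ a a′ b c → (1 ≤ ⟦ a ⟧ → 1 ≤ ⟦ a′ ⟧ ⊎ 1 ≤ ⟦ b ⟧ + ⟦ c ⟧) → ⟦ none a′ b c ⟧ ≤ ⟦ none a b c ⟧
none-antitone a     true  b     c     f = z≤n
none-antitone a     false true  c     f = z≤n
none-antitone a     false false true  f = z≤n
none-antitone false false false false f = s≤s z≤n
none-antitone true  false false false f = case f (s≤s z≤n) of λ { (inj₁ ()) ; (inj₂ ()) }

twice-cases : ∀ a b c → 1 ≤ ⟦ twice a b c ⟧ →
  1 ≤ ⟦ a ⟧ × 1 ≤ ⟦ b ⟧ + ⟦ c ⟧ ⊎ 1 ≤ ⟦ b ⟧ × 1 ≤ ⟦ c ⟧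
twice-cases true  true  c    _ = inj₁ (s≤s z≤n , s≤s z≤n)
twice-cases true  false true _ = inj₁ (s≤s z≤n , s≤s z≤n)
twice-cases false true  true _ = inj₂ (s≤s z≤n , s≤s z≤n)

once : Bool → Bool → ℕ
once x t = ⟦ x ∧ not t ⟧

once-split : ∀ x t → ⟦ x ⟧ ≡ once x t + ⟦ x ⟧ * ⟦ t ⟧
once-split false t     = refl
once-split true  false = refl
once-split true  true  = refl

coverage : ∀ a b c → let t = twice a b c in
  1 ≤ ⟦ none a b c ⟧ + (⟦ t ⟧ + (once a t + (once b t + once c t)))
coverage false false false = s≤s z≤n
coverage false false true  = s≤s z≤n
coverage false true  false = s≤s z≤n
coverage false true  true  = s≤s z≤n
coverage true  false false = s≤s z≤n
coverage true  false true  = s≤s z≤n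
coverage true  true  c     = s≤s z≤n

-- Covered at least twice but not three times means absent from exactly one matching. The sum form
-- is what `initial-corner` later cancels against `degree-single`.
absent-colour : ∀ (b : Colour → Bool) → 1 ≤ ⟦ twice (b 0F) (b 1F) (b 2F) ⟧ →
  ⟦ all³ (b 0F) (b 1F) (b 2F) ⟧ ≡ 0 → ∃[ c ] (∀ i → δ c i + ⟦ b i ⟧ ≡ 1)
absent-colour b p q with b 0F in e₀ | b 1F in e₁ | b 2F in e₂
... | false | true  | true  = 0F , λ { 0F → cong (suc ∘ ⟦_⟧) e₀ ; 1F → cong ⟦_⟧ e₁ ; 2F → cong ⟦_⟧ e₂ }
... | true  | false | true  = 1F , λ { 0F → cong ⟦_⟧ e₀ ; 1F → cong (suc ∘ ⟦_⟧) e₁ ; 2F → cong ⟦_⟧ e₂ }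
... | true  | true  | false = 2F , λ { 0F → cong ⟦_⟧ e₀ ; 1F → cong ⟦_⟧ e₁ ; 2F → cong (suc ∘ ⟦_⟧) e₂ }

combination₁ : ∀ x y z → x * 1 + (y * 0 + z * 0) ≡ x
combination₁ x y z rewrite ℕₚ.*-identityʳ x | ℕₚ.*-zeroʳ y | ℕₚ.*-zeroʳ z = ℕₚ.+-identityʳ x

combination₂ : ∀ x y z → x * 0 + (y * 1 + z * 0) ≡ y
combination₂ x y z rewrite ℕₚ.*-zeroʳ x | ℕₚ.*-identityʳ y | ℕₚ.*-zeroʳ z = ℕₚ.+-identityʳ y

combination₃ : ∀ x y z → x * 0 + (y * 0 + z * 1) ≡ z
combination₃ x y z rewrite ℕₚ.*-zeroʳ x | ℕₚ.*-zeroʳ y | ℕₚ.*-identityʳ z = refl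

-- Exchanging parallel edges in a matching.

module Core (G : Multigraph) (cubic : Cubic G) where
  open Multigraph G
  open Degrees G

  missed : EdgeSet → EdgeSet → EdgeSet → Weight
  missed A B C e = ⟦ none (lookup A e) (lookup B e) (lookup C e) ⟧

  uncovered≡sum : ∀ A B C → uncovered G A B C ≡ sum (missed A B C)
  uncovered≡sum A B C = trans (∣∣≡sum (∁ (A ∪ B ∪ C))) (sum-cong-≗ λ e → cong ⟦_⟧
    (trans (lookup-map e not (A ∪ B ∪ C)) (cong not (trans (lookup-zipWith _∨_ e A (B ∪ C))
      (cong (lookup A e ∨_) (lookup-zipWith _∨_ e B C))))))

  degree-one : ∀ v → degree (λ _ → 1) v ≡ 3
  degree-one v = trans (degree-cong (λ e → cong ⟦_⟧ (sym (lookup-replicate e true))) v)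
    (trans (sym (degreeIn≡degree ⊤ v)) (cubic v))

  perfect-degree : ∀ S → PerfectMatching G S → ∀ v → degree (indicator S) v ≡ 1
  perfect-degree S perfect v = trans (sym (degreeIn≡degree S v)) (perfect v)

  -- Parallel edges have the same incidences, so replacing `d` by `e` in `A` keeps it perfect. This
  -- covers `e`, while `d` stays covered by `B` or `C`.
  exchange : ∀ A B C → PerfectMatching G A → ∀ {e d} →
    1 ≤ missed A B C e → 1 ≤ indicator A d → 1 ≤ indicator B d + indicator C d →
    (∀ v → inc e v ≡ inc d v) →
    ∃[ A′ ] (PerfectMatching G A′ × suc (sum (missed A′ B C)) ≤ sum (missed A B C))
  exchange A B C perfect {e} {d} e-missed d∈A d∈BC parallel =
    let A′ , perfect′ , same = perfectMatching-of-weight f regular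
    in A′ , perfect′ , subst (_≤ sum (missed A B C))
         (trans (∑-distrib-+ (δ e) (missed A′ B C)) (cong (_+ sum (missed A′ B C)) (sum-δ e)))
         (sum-mono (fewer A′ same))
    where
    f : Weight
    f a = δ e a + (indicator A ⊖ d) a

    regular : ∀ v → degree f v ≡ 1
    regular v = trans (degree-δ+ e (indicator A ⊖ d) v)
      (trans (cong (_+ degree (indicator A ⊖ d) v) (parallel v))
        (trans (sym (degree-⊖ (indicator A) d∈A v)) (perfect-degree A perfect v)))

    fewer : ∀ A′ → (∀ a → indicator A′ a ≡ f a) → ∀ a → δ e a + missed A′ B C a ≤ missed A B C a
    fewer A′ same a with e ≟ a
    ... | yes refl = subst (λ k → 1 + k ≤ missed A B C e) (sym zero-at-e) e-missed
      where
      zero-at-e : missed A′ B C e ≡ 0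
      zero-at-e with lookup A′ e in eq
      ... | true  = refl
      ... | false = case trans (sym (cong ⟦_⟧ eq))
        (trans (same e) (cong (_+ (indicator A ⊖ d) e) (δ-refl e))) of λ ()
    ... | no e≢a = none-antitone (lookup A a) (lookup A′ a) (lookup B a) (lookup C a) kept
      where
      kept : 1 ≤ indicator A a → 1 ≤ indicator A′ a ⊎ 1 ≤ indicator B a + indicator C a
      kept p with d ≟ a
      ... | yes refl = inj₂ d∈BC
      ... | no d≢a   = inj₁ (subst (1 ≤_) (sym (trans (same a)
        (cong₂ (λ x y → x + (indicator A a ∸ y)) (δ-≢ e≢a) (δ-≢ d≢a)))) p)

-- Missed edges of an optimal triple of perfect matchings.

module Defect (G : Multigraph) (cubic : Cubic G) (bridgeless : Bridgeless G)
  (M : Fin 3 → Multigraph.EdgeSet G) (perfect : ∀ i → PerfectMatching G (M i))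
  (three : uncovered G (M 0F) (M 1F) (M 2F) ≡ 3)
  (minimal : ∀ A B C → PerfectMatching G A → PerfectMatching G B → PerfectMatching G C → 3 ≤ uncovered G A B C)
  where
  open Multigraph G
  open Degrees G
  open Core G cubic

  Z D T : Weight
  Z = missed (M 0F) (M 1F) (M 2F)
  D e = ⟦ twice (lookup (M 0F) e) (lookup (M 1F) e) (lookup (M 2F) e) ⟧
  T e = ⟦ all³ (lookup (M 0F) e) (lookup (M 1F) e) (lookup (M 2F) e) ⟧

  m : Fin 3 → Weight
  m i = indicator (M i)

  sum-Z : sum Z ≡ 3
  sum-Z = trans (sym (uncovered≡sum (M 0F) (M 1F) (M 2F))) three

  degree-m : ∀ i v → degree (m i) v ≡ 1
  degree-m i = perfect-degree (M i) (perfect i)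

  -- Three matchings use three edge ends at `v`, exactly the degree of `v` in a cubic graph; so what
  -- is missed there equals what is covered in excess. This is `balance` summed around `v`.
  degree-Z : ∀ v → degree Z v ≡ degree D v + degree T v
  degree-Z v = ℕₚ.+-cancelˡ-≡ 3 _ _ (begin
    3 + degree Z v
      ≡⟨ cong₂ _+_ (sym (degree-m 0F v)) (cong₂ _+_ (sym (degree-m 1F v))
          (cong (_+ degree Z v) (sym (degree-m 2F v)))) ⟩
    degree (m 0F) v + (degree (m 1F) v + (degree (m 2F) v + degree Z v))
      ≡⟨ cong (λ k → degree (m 0F) v + (degree (m 1F) v + k)) (sym (degree-+ (m 2F) Z v)) ⟩
    degree (m 0F) v + (degree (m 1F) v + degree (λ e → m 2F e + Z e) v)
      ≡⟨ cong (degree (m 0F) v +_) (sym (degree-+ (m 1F) _ v)) ⟩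
    degree (m 0F) v + degree (λ e → m 1F e + (m 2F e + Z e)) v
      ≡⟨ sym (degree-+ (m 0F) _ v) ⟩
    degree (λ e → m 0F e + (m 1F e + (m 2F e + Z e))) v
      ≡⟨ degree-cong (λ e → balance (lookup (M 0F) e) (lookup (M 1F) e) (lookup (M 2F) e)) v ⟩
    degree (λ e → 1 + (D e + T e)) v
      ≡⟨ degree-+ (λ _ → 1) (λ e → D e + T e) v ⟩
    degree (λ _ → 1) v + degree (λ e → D e + T e) v
      ≡⟨ cong₂ _+_ (degree-one v) (degree-+ D T v) ⟩
    3 + (degree D v + degree T v) ∎)

  degree-Z+D : ∀ v → degree Z v + degree D v ≤ 3
  degree-Z+D v = subst₂ _≤_ (degree-+ Z D v) (degree-one v)
    (degree-mono {g = λ _ → 1} (λ e → none+twice≤1 (lookup (M 0F) e) (lookup (M 1F) e) (lookup (M 2F) e)) v)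

  T≤D : ∀ e → T e ≤ D e
  T≤D e = all³≤twice (lookup (M 0F) e) (lookup (M 1F) e) (lookup (M 2F) e)

  no-exchange : ∀ A B C → PerfectMatching G A → PerfectMatching G B → PerfectMatching G C →
    sum (missed A B C) ≡ 3 → ∀ {e d u w} → 1 ≤ missed A B C e →
    1 ≤ indicator A d → 1 ≤ indicator B d + indicator C d → Joins e u w → Joins d u w → ⊥
  no-exchange A B C pA pB pC three′ {e} {d} e-missed d∈A d∈BC je jd =
    let A′ , pA′ , fewer = exchange A B C pA {e} {d} e-missed d∈A d∈BC
          (λ v → trans (incidence je v) (sym (incidence jd v)))
    in ℕₚ.<⇒≱ (subst (suc (sum (missed A′ B C)) ≤_) three′ fewer)
         (subst (3 ≤_) (uncovered≡sum A′ B C) (minimal A′ B C pA′ pB pC))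

  no-parallel : ∀ {e d u w} → 1 ≤ Z e → 1 ≤ D d → Joins e u w → Joins d u w → ⊥
  no-parallel {e} {d} Ze Dd je jd with twice-cases (lookup (M 0F) d) (lookup (M 1F) d) (lookup (M 2F) d) Dd
  ... | inj₁ (p , q) = no-exchange (M 0F) (M 1F) (M 2F) (perfect 0F) (perfect 1F) (perfect 2F) sum-Z
                         {d = d} Ze p q je jd
  -- `exchange` alters the first matching only, so the first two trade places when `d` lies in the
  -- second and third.
  ... | inj₂ (p , q) = no-exchange (M 1F) (M 0F) (M 2F) (perfect 1F) (perfect 0F) (perfect 2F)
                         (trans (sum-cong-≗ swapped) sum-Z)
                         {d = d} (subst (1 ≤_) (sym (swapped e)) Ze) p (ℕₚ.≤-trans q (ℕₚ.m≤n+m _ _)) je jd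
    where
    swapped : ∀ a → missed (M 1F) (M 0F) (M 2F) a ≡ Z a
    swapped a = cong ⟦_⟧ (none-swap (lookup (M 1F) a) (lookup (M 0F) a) (lookup (M 2F) a))

  -- The loop gives `Z` degree at least 2 at `u`. Without a triply covered edge there, `D` would
  -- have the same degree, and the two together would exceed 3.
  loop-at-triple : ∀ {ℓ u} → 1 ≤ Z ℓ → Joins ℓ u u → ∃[ f ] (1 ≤ T f × 1 ≤ inc f u)
  loop-at-triple {ℓ} {u} Zℓ loop = degree-positive T (few (degree Z u) (degree D u) (degree T u)
      (ℕₚ.≤-trans two (inc≤degree Z Zℓ u)) (degree-Z u) (degree-Z+D u))
    where
    two : 2 ≤ inc ℓ u
    two = ℕₚ.≤-reflexive (sym (trans (incidence loop u) (cong₂ _+_ (δ-refl u) (δ-refl u))))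

    few : ∀ z d t → 2 ≤ z → z ≡ d + t → z + d ≤ 3 → 1 ≤ t
    few z d (suc t) _ _ _ = s≤s z≤n
    few z d zero two z≡ ≤3 = case ℕₚ.≤-trans (ℕₚ.+-mono-≤ two
      (ℕₚ.≤-trans two (ℕₚ.≤-reflexive (trans z≡ (ℕₚ.+-identityʳ d))))) ≤3 of λ { (s≤s (s≤s (s≤s ()))) }

  Z∧T : ∀ e → 1 ≤ Z e → 1 ≤ T e → ⊥
  Z∧T e p q = ℕₚ.<⇒≱ (ℕₚ.+-mono-≤ p (ℕₚ.≤-trans q (T≤D e)))
    (none+twice≤1 (lookup (M 0F) e) (lookup (M 1F) e) (lookup (M 2F) e))

  T⇒m : ∀ e → 1 ≤ T e → 1 ≤ m 0F e
  T⇒m e p with lookup (M 0F) e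
  ... | true = s≤s z≤n

  matched-loop-free : ∀ {i e u w} → 1 ≤ m i e → Joins e u w → u ≢ w
  matched-loop-free {i} {e} {u} p = loop-free (ℕₚ.≤-trans (inc≤degree (m i) p u) (ℕₚ.≤-reflexive (degree-m i u)))

  -- A triply matched edge sharing a vertex with a loop is a bridge.
  loop-excludes-triple : ∀ {ℓ f u} → 1 ≤ Z ℓ → Joins ℓ u u → 1 ≤ T f → 1 ≤ inc f u → ⊥
  loop-excludes-triple {ℓ} {f} {u} Zℓ loop Tf f∋u =
    bridgeless f λ path → matched-loop-free {0F} (T⇒m f Tf) (joins-ends f) (both (stuck path))
    where
    -- The loop takes two of the three ends at `u` and `f` the third; a further edge would raise the
    -- degree to 4.
    only : ∀ e → 1 ≤ inc e u → e ≢ f → e ≡ ℓ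
    only e p e≢f with ℓ ≟ e
    ... | yes refl = refl
    ... | no ℓ≢e   = contradiction
      (subst₂ _≤_ (trans (degree-δ+ ℓ (λ a → δ f a + δ e a) u)
          (cong (inc ℓ u +_) (trans (degree-δ+ f (δ e) u) (cong (inc f u +_) (degree-δ e u)))))
        (degree-one u) (degree-mono {g = λ _ → 1} distinct u))
      (ℕₚ.<⇒≱ (ℕₚ.+-mono-≤ (ℕₚ.≤-reflexive (sym (trans (incidence loop u) (cong₂ _+_ (δ-refl u) (δ-refl u)))))
        (ℕₚ.+-mono-≤ f∋u p)))
      where
      distinct : ∀ a → δ ℓ a + (δ f a + δ e a) ≤ 1
      distinct a with ℓ ≟ a | f ≟ a | e ≟ a
      ... | yes refl | yes refl | _        = ⊥-elim (Z∧T ℓ Zℓ Tf)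
      ... | yes refl | no _     | yes refl = contradiction refl ℓ≢e
      ... | yes _    | no _     | no _     = s≤s z≤n
      ... | no _     | yes refl | yes refl = contradiction refl e≢f
      ... | no _     | yes _    | no _     = s≤s z≤n
      ... | no _     | no _     | yes _    = s≤s z≤n
      ... | no _     | no _     | no _     = z≤n

    at-loop : ∀ {w} → 1 ≤ inc ℓ w → u ≡ w
    at-loop {w} p = [ δ-positive , δ-positive ]′ (positive-+ (δ u w) (subst (1 ≤_) (incidence loop w) p))

    first : ∀ {e a b} → ends e ≡ (a , b) → 1 ≤ inc e a
    first {e} refl = Joins-left (joins-ends e)

    second : ∀ {e a b} → ends e ≡ (a , b) → 1 ≤ inc e b
    second {e} refl = Joins-right (joins-ends e)

    ends-inc : ∀ {e a b} → ends e ≡ (a , b) ⊎ ends e ≡ (b , a) → 1 ≤ inc e a × 1 ≤ inc e b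
    ends-inc (inj₁ p) = first p , second p
    ends-inc (inj₂ p) = second p , first p

    -- Without `f` only the loop is left at `u`, so being equal to `u` is invariant along walks
    -- avoiding `f`.
    step : ∀ {a b} → AdjacentIn G (∁ ⁅ f ⁆) a b → (u ≡ a → u ≡ b) × (u ≡ b → u ≡ a)
    step {a} {b} (e , e∈ , joined) = (λ { refl → at-loop (subst (λ x → 1 ≤ inc x b) (only e pa e≢f) pb) }) ,
                                     (λ { refl → at-loop (subst (λ x → 1 ≤ inc x a) (only e pb e≢f) pa) })
      where
      pa = proj₁ (ends-inc joined)
      pb = proj₂ (ends-inc joined)
      e≢f : e ≢ f
      e≢f refl = x∈∁p⇒x∉p e∈ (x∈⁅x⁆ f)

    stuck : ∀ {a b} → ConnectedIn G (∁ ⁅ f ⁆) a b → (u ≡ a → u ≡ b) × (u ≡ b → u ≡ a)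
    stuck ε       = id , id
    stuck (s ◅ p) = proj₁ (stuck p) ∘ proj₁ (step s) , proj₂ (step s) ∘ proj₂ (stuck p)

    both : (u ≡ proj₁ (ends f) → u ≡ proj₂ (ends f)) × (u ≡ proj₂ (ends f) → u ≡ proj₁ (ends f)) →
      proj₁ (ends f) ≡ proj₂ (ends f)
    both (forth , back) = [ (λ p → let q = sym (δ-positive p) in trans (sym q) (forth q))
                          , (λ p → let q = sym (δ-positive p) in trans (sym (back q)) q) ]′
      (positive-+ (δ (proj₁ (ends f)) u) f∋u)

  no-loop : ∀ {ℓ u} → 1 ≤ Z ℓ → Joins ℓ u u → ⊥
  no-loop Zℓ loop = let f , Tf , f∋u = loop-at-triple Zℓ loop in loop-excludes-triple Zℓ loop Tf f∋u

  missed-loop-free : ∀ {e u w} → 1 ≤ Z e → Joins e u w → u ≢ w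
  missed-loop-free Ze j refl = no-loop Ze j

  -- Otherwise both ends of f see two of the three missed edges, one of which is
  -- therefore parallel to f.
  no-triple : ∀ f → T f ≡ 0
  no-triple f with positive⊎zero (T f)
  ... | inj₂ Tf≡0 = Tf≡0
  ... | inj₁ Tf   = ⊥-elim (ℕₚ.<⇒≱ (ℕₚ.+-mono-≤ (two u (Joins-left jf)) (two w (Joins-right jf)))
      (subst₂ _≤_ split sum-Z (sum-mono single)))
    where
    u w : Vertex
    u = proj₁ (ends f)
    w = proj₂ (ends f)
    jf : Joins f u w
    jf = joins-ends f

    two : ∀ x → 1 ≤ inc f x → 2 ≤ degree Z x
    two x p = subst (2 ≤_) (sym (degree-Z x)) (ℕₚ.+-mono-≤
      (ℕₚ.≤-trans p (inc≤degree D (ℕₚ.≤-trans Tf (T≤D f)) x)) (ℕₚ.≤-trans p (inc≤degree T Tf x)))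

    split : sum (λ e → Z e * inc e u + Z e * inc e w) ≡ degree Z u + degree Z w
    split = ∑-distrib-+ (λ e → Z e * inc e u) (λ e → Z e * inc e w)

    not-both : ∀ e → 1 ≤ Z e → inc e u + inc e w ≤ 1
    not-both e Ze with positive⊎zero (inc e u)
    ... | inj₁ p = let x , j = other-end p in
      subst (_≤ 1) (sym (trans (cong₂ _+_ (incidence j u) (incidence j w))
        (cong₂ _+_ (cong₂ _+_ (δ-refl u) (δ-≢ (missed-loop-free Ze j ∘ sym)))
          (cong₂ _+_ (δ-≢ (matched-loop-free {0F} (T⇒m f Tf) jf))
            (δ-≢ {i = x} {j = w} λ x≡w →
              no-parallel Ze (ℕₚ.≤-trans Tf (T≤D f)) (subst (Joins e u) x≡w j) jf))))) ℕₚ.≤-refl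
    ... | inj₂ p with positive⊎zero (inc e w)
    ...   | inj₂ q = subst (_≤ 1) (sym (cong₂ _+_ p q)) z≤n
    ...   | inj₁ q = let x , j = other-end q in
      subst (_≤ 1) (sym (cong₂ _+_ p (trans (incidence j w)
        (cong₂ _+_ (δ-refl w) (δ-≢ (missed-loop-free Ze j ∘ sym)))))) ℕₚ.≤-refl

    single : ∀ e → Z e * inc e u + Z e * inc e w ≤ Z e
    single e with positive⊎zero (Z e)
    ... | inj₂ q rewrite q = z≤n
    ... | inj₁ q = subst₂ _≤_ (ℕₚ.*-distribˡ-+ (Z e) (inc e u) (inc e w)) (ℕₚ.*-identityʳ (Z e))
      (ℕₚ.*-monoʳ-≤ (Z e) (not-both e q))

  degree-Z≡D : ∀ v → degree Z v ≡ degree D v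
  degree-Z≡D v = trans (degree-Z v) (trans (cong (degree D v +_)
    (sum-zero λ e → cong (_* inc e v) (no-triple e))) (ℕₚ.+-identityʳ _))

  -- Equal degrees of total at most 3 are at most 1. Hence the missed edges are pairwise disjoint,
  -- and so are the doubly covered ones.
  degree-Z≤1 : ∀ v → degree Z v ≤ 1
  degree-Z≤1 v with degree Z v | degree-Z+D v | degree-Z≡D v
  ... | 0           | _ | _    = z≤n
  ... | 1           | _ | _    = s≤s z≤n
  ... | suc (suc k) | p | q rewrite sym q | ℕₚ.+-suc k (suc k) =
    case p of λ { (s≤s (s≤s (s≤s r))) → case subst (_≤ 0) (ℕₚ.+-suc k k) r of λ () }

  Match : Weight → Vertex → List Vertex → Set
  Match W x L = ∃[ d ] ∃[ y ] Σ[ p ∈ Any (y ≡_) L ]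
    (1 ≤ W d × Joins d x y × (∀ v → degree (W ⊖ d) v ≡ occurrences (L ─ p) v))

  -- One step of the alternating walk. Since `x` is listed, some edge of `W` meets it; after `x` is
  -- cancelled, the other end must occur in `L`, and that single occurrence is struck out.
  match : ∀ W x L → (∀ v → degree W v ≡ occurrences (x ∷ L) v) → Match W x L
  match W x L degrees
    with d , Wd , d∋x ← degree-positive W {x} (subst (1 ≤_) (sym (degrees x))
                          (subst (λ k → 1 ≤ k + occurrences L x) (sym (δ-refl x)) (s≤s z≤n)))
    with y , j ← other-end d∋x
    = d , y , p , Wd , j , λ v → ℕₚ.+-cancelˡ-≡ (δ y v) _ _ (trans (rest v) (occurrences-remove L p v))
    where
    rest : ∀ v → δ y v + degree (W ⊖ d) v ≡ occurrences L v
    rest v = ℕₚ.+-cancelˡ-≡ (δ x v) _ _ (trans (sym (ℕₚ.+-assoc (δ x v) (δ y v) _))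
      (trans (cong (_+ degree (W ⊖ d) v) (sym (incidence j v))) (trans (sym (degree-⊖ W Wd v)) (degrees v))))

    p : Any (y ≡_) L
    p = occurs L (subst (1 ≤_) (rest y) (subst (λ k → 1 ≤ k + degree (W ⊖ d) y) (sym (δ-refl y)) (s≤s z≤n)))

  no-degree : ∀ W → (∀ v → degree W v ≡ 0) → ∀ e → W e ≡ 0
  no-degree W zero-degree e with positive⊎zero (W e)
  ... | inj₂ q = q
  ... | inj₁ p = case ℕₚ.≤-trans (Joins-left (joins-ends e))
                   (ℕₚ.≤-trans (inc≤degree W p _) (ℕₚ.≤-reflexive (zero-degree _))) of λ ()

  -- The alternating hexagon.

  record Hexagonal : Set where
    field
      v           : Corner → Vertex
      h           : Corner → Edge
      v-injective : ∀ {k l} → v k ≡ v l → k ≡ l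
      h-joins     : ∀ k → Joins (h k) (v k) (v (next k))
      missed-h    : ∀ e → 1 ≤ Z e → h 0F ≡ e ⊎ h 2F ≡ e ⊎ h 4F ≡ e
      twice-h     : ∀ e → D e ≡ δ (h 1F) e + (δ (h 3F) e + δ (h 5F) e)

  record MissedEdges (e₁ e₂ e₃ : Edge) : Set where
    field
      missed₁ : 1 ≤ Z e₁
      missed₂ : 1 ≤ Z e₂
      missed₃ : 1 ≤ Z e₃
      exhaust : ∀ e → 1 ≤ Z e → e₁ ≡ e ⊎ e₂ ≡ e ⊎ e₃ ≡ e
      degrees : ∀ v → degree Z v ≡ inc e₁ v + (inc e₂ v + inc e₃ v)

  MissedEdges-swap : ∀ {e₁ e₂ e₃} → MissedEdges e₁ e₂ e₃ → MissedEdges e₁ e₃ e₂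
  MissedEdges-swap {e₁} {e₂} {e₃} E = record
    { missed₁ = missed₁ ; missed₂ = missed₃ ; missed₃ = missed₂
    ; exhaust = λ e p → case exhaust e p of λ
        { (inj₁ q) → inj₁ q ; (inj₂ (inj₁ q)) → inj₂ (inj₂ q) ; (inj₂ (inj₂ q)) → inj₂ (inj₁ q) }
    ; degrees = λ v → trans (degrees v) (cong (inc e₁ v +_) (ℕₚ.+-comm (inc e₂ v) (inc e₃ v)))
    }
    where open MissedEdges E

  ⊖⊖≤ : ∀ (W : Weight) a b e → (W ⊖ a ⊖ b) e ≤ W e
  ⊖⊖≤ W a b e = ℕₚ.≤-trans (⊖≤ (W ⊖ a) b e) (⊖≤ W a e)

  extract : ∀ (W : Weight) k → sum W ≡ suc k → ∃[ e ] (1 ≤ W e × sum (W ⊖ e) ≡ k)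
  extract W k size =
    let e , p = sum-positive {f = W} (subst (1 ≤_) (sym size) (s≤s z≤n))
    in e , p , ℕₚ.suc-injective (trans (sym (sum-⊖ W p)) size)

  peel-three : ∀ (W : Weight) {d₁ d₂ d₃} → 1 ≤ W d₁ → 1 ≤ (W ⊖ d₁) d₂ → 1 ≤ (W ⊖ d₁ ⊖ d₂) d₃ →
    (∀ e → (W ⊖ d₁ ⊖ d₂ ⊖ d₃) e ≡ 0) → ∀ e → W e ≡ δ d₁ e + (δ d₂ e + δ d₃ e)
  peel-three W {d₁} {d₂} {d₃} p₁ p₂ p₃ nothing e =
    trans (⊖-split W p₁ e) (cong (δ d₁ e +_)
      (trans (⊖-split (W ⊖ d₁) p₂ e) (cong (δ d₂ e +_)
        (trans (⊖-split (W ⊖ d₁ ⊖ d₂) p₃ e)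
          (trans (cong (δ d₃ e +_) (nothing e)) (ℕₚ.+-identityʳ (δ d₃ e)))))))

  degree-three : ∀ a b c v → degree (λ e → δ a e + (δ b e + δ c e)) v ≡ inc a v + (inc b v + inc c v)
  degree-three a b c v = trans (degree-δ+ a (λ e → δ b e + δ c e) v)
    (cong (inc a v +_) (trans (degree-δ+ b (δ c) v) (cong (inc b v +_) (degree-δ c v))))

  one-of-three : ∀ {a b c e : Edge} → 1 ≤ δ a e + (δ b e + δ c e) → a ≡ e ⊎ b ≡ e ⊎ c ≡ e
  one-of-three {a} {b} {c} {e} p = [ inj₁ ∘ δ-positive ,
    (λ q → inj₂ ([ inj₁ ∘ δ-positive , inj₂ ∘ δ-positive ]′ (positive-+ (δ b e) q))) ]′ (positive-+ (δ a e) p)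

  missed-of-split : ∀ {e₁ e₂ e₃} → (∀ e → Z e ≡ δ e₁ e + (δ e₂ e + δ e₃ e)) →
    1 ≤ Z e₁ → 1 ≤ Z e₂ → 1 ≤ Z e₃ → MissedEdges e₁ e₂ e₃
  missed-of-split {e₁} {e₂} {e₃} split p₁ p₂ p₃ = record
    { missed₁ = p₁ ; missed₂ = p₂ ; missed₃ = p₃
    ; exhaust = λ e p → one-of-three (subst (1 ≤_) (split e) p)
    ; degrees = λ v → trans (degree-cong split v) (degree-three e₁ e₂ e₃ v)
    }

  missed-edges : ∃[ e₁ ] ∃[ e₂ ] ∃[ e₃ ] MissedEdges e₁ e₂ e₃
  missed-edges =
    let e₁ , p₁ , s₁ = extract Z 2 sum-Z
        e₂ , p₂ , s₂ = extract (Z ⊖ e₁) 1 s₁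
        e₃ , p₃ , s₃ = extract (Z ⊖ e₁ ⊖ e₂) 0 s₂
    in e₁ , e₂ , e₃ , missed-of-split
      (peel-three Z {e₁} {e₂} {e₃} p₁ p₂ p₃ λ e → ℕₚ.n≤0⇒n≡0
        (ℕₚ.≤-trans (term≤sum (Z ⊖ e₁ ⊖ e₂ ⊖ e₃) e) (ℕₚ.≤-reflexive s₃)))
      p₁ (ℕₚ.≤-trans p₂ (⊖≤ Z e₁ e₂)) (ℕₚ.≤-trans p₃ (⊖⊖≤ Z e₁ e₂ e₃))

  close : ∀ {e₁ e₂ e₃ a₁ b₁ a₂ b₂ a₃ b₃ d₁ d₂ d₃} → MissedEdges e₁ e₂ e₃ →
    Joins e₁ a₁ b₁ → Joins e₂ a₂ b₂ → Joins e₃ a₃ b₃ →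
    Joins d₁ b₁ a₂ → Joins d₂ b₂ a₃ → Joins d₃ b₃ a₁ →
    1 ≤ D d₁ → 1 ≤ (D ⊖ d₁) d₂ → 1 ≤ (D ⊖ d₁ ⊖ d₂) d₃ → (∀ v → degree (D ⊖ d₁ ⊖ d₂ ⊖ d₃) v ≡ 0) → Hexagonal
  close {e₁} {e₂} {e₃} {a₁} {b₁} {a₂} {b₂} {a₃} {b₃} {d₁} {d₂} {d₃} E j₁ j₂ j₃ k₁ k₂ k₃ p₁ p₂ p₃ nothing = record
    { v = corner
    ; h = lookup (e₁ ∷ d₁ ∷ e₂ ∷ d₂ ∷ e₃ ∷ d₃ ∷ [])
    -- The corners are the six ends of the missed edges, counted at each vertex by `degree Z`, hence
    -- distinct.
    ; v-injective = injective-of-sum≤1 corner λ x → subst (_≤ 1) (trans (degrees x) (expand x)) (degree-Z≤1 x)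
    ; h-joins = λ { 0F → j₁ ; 1F → k₁ ; 2F → j₂ ; 3F → k₂ ; 4F → j₃ ; 5F → k₃ }
    ; missed-h = exhaust
    ; twice-h = peel-three D {d₁} {d₂} {d₃} p₁ p₂ p₃ (no-degree (D ⊖ d₁ ⊖ d₂ ⊖ d₃) nothing)
    }
    where
    open MissedEdges E
    corner : Corner → Vertex
    corner = lookup (a₁ ∷ b₁ ∷ a₂ ∷ b₂ ∷ a₃ ∷ b₃ ∷ [])

    expand : ∀ x → inc e₁ x + (inc e₂ x + inc e₃ x) ≡ sum (λ i → δ (corner i) x)
    expand x = trans (cong₂ _+_ (incidence j₁ x) (cong₂ _+_ (incidence j₂ x) (incidence j₃ x)))
      (trans (ℕₚ.+-assoc (δ a₁ x) (δ b₁ x) _) (cong (λ k → δ a₁ x + (δ b₁ x + k))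
        (trans (ℕₚ.+-assoc (δ a₂ x) (δ b₂ x) _)
          (cong (λ k → δ a₂ x + (δ b₂ x + (δ a₃ x + k))) (sym (ℕₚ.+-identityʳ _))))))

  -- The alternating walk, once its first doubly covered edge goes from b₁ to a₂.
  continue : ∀ {e₁ e₂ e₃ a₁ b₁ a₂ b₂ a₃ b₃ d₁} → MissedEdges e₁ e₂ e₃ →
    Joins e₁ a₁ b₁ → Joins e₂ a₂ b₂ → Joins e₃ a₃ b₃ → 1 ≤ D d₁ → Joins d₁ b₁ a₂ →
    (∀ v → degree (D ⊖ d₁) v ≡ occurrences (b₂ ∷ a₁ ∷ a₃ ∷ b₃ ∷ []) v) → Hexagonal
  continue {e₁} {e₂} {e₃} {a₁} {b₁} {a₂} {b₂} {a₃} {b₃} {d₁} E j₁ j₂ j₃ p₁ k₁ degrees₁ =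
    second (match (D ⊖ d₁) b₂ (a₁ ∷ a₃ ∷ b₃ ∷ []) degrees₁)
    where
    open MissedEdges E

    last : ∀ {b a d₂} → Joins e₃ a b → 1 ≤ (D ⊖ d₁) d₂ → Joins d₂ b₂ a →
      Match (D ⊖ d₁ ⊖ d₂) b (a₁ ∷ []) → Hexagonal
    last {d₂ = d₂} j p₂ k₂ (d₃ , _ , here refl , p₃ , k₃ , nothing) =
      close {d₁ = d₁} {d₂ = d₂} {d₃ = d₃} E j₁ j₂ j k₁ k₂ k₃ p₁ p₂ p₃ nothing

    parallel : ∀ {d₂} → Match (D ⊖ d₁ ⊖ d₂) a₃ (b₃ ∷ []) → Hexagonal
    parallel {d₂} (d₃ , _ , here refl , p₃ , k₃ , _) =
      ⊥-elim (no-parallel missed₃ (ℕₚ.≤-trans p₃ (⊖⊖≤ D d₁ d₂ d₃)) j₃ k₃)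

    second : Match (D ⊖ d₁) b₂ (a₁ ∷ a₃ ∷ b₃ ∷ []) → Hexagonal
    -- Returning to `a₁` would close a 4-cycle; the last doubly covered edge would then be parallel
    -- to `e₃`.
    second (d₂ , _ , here refl , p₂ , k₂ , degrees₂) =
      parallel {d₂} (match (D ⊖ d₁ ⊖ d₂) a₃ (b₃ ∷ []) degrees₂)
    second (d₂ , _ , there (here refl) , p₂ , k₂ , degrees₂) = last {d₂ = d₂} j₃ p₂ k₂
      (match (D ⊖ d₁ ⊖ d₂) b₃ (a₁ ∷ []) λ v → trans (degrees₂ v) (+-swap (δ a₁ v) (δ b₃ v) 0))
    second (d₂ , _ , there (there (here refl)) , p₂ , k₂ , degrees₂) = last {d₂ = d₂} (Joins-sym j₃) p₂ k₂
      (match (D ⊖ d₁ ⊖ d₂) a₃ (a₁ ∷ []) λ v → trans (degrees₂ v) (+-swap (δ a₁ v) (δ a₃ v) 0))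

  -- The edge of `D` at `b₁` cannot lead back to `a₁`, being then parallel to `e₁`. The four
  -- remaining targets all become `a₂` after swapping `e₂` with `e₃` or reversing the one that is
  -- reached.
  hexagonal-of : ∀ {e₁ e₂ e₃ a₁ b₁ a₂ b₂ a₃ b₃} → MissedEdges e₁ e₂ e₃ →
    Joins e₁ a₁ b₁ → Joins e₂ a₂ b₂ → Joins e₃ a₃ b₃ → Hexagonal
  hexagonal-of {e₁} {e₂} {e₃} {a₁} {b₁} {a₂} {b₂} {a₃} {b₃} E j₁ j₂ j₃ =
    start-at (match D b₁ (a₁ ∷ a₂ ∷ b₂ ∷ a₃ ∷ b₃ ∷ []) degrees-D)
    where
    open MissedEdges E

    degrees-D : ∀ v → degree D v ≡ occurrences (b₁ ∷ a₁ ∷ a₂ ∷ b₂ ∷ a₃ ∷ b₃ ∷ []) v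
    degrees-D v = trans (sym (degree-Z≡D v)) (trans (degrees v)
      (trans (cong₂ _+_ (trans (incidence j₁ v) (ℕₚ.+-comm (δ a₁ v) (δ b₁ v)))
          (cong₂ _+_ (incidence j₂ v) (trans (incidence j₃ v) (cong (δ a₃ v +_) (sym (ℕₚ.+-identityʳ (δ b₃ v)))))))
        (trans (ℕₚ.+-assoc (δ b₁ v) (δ a₁ v) _)
          (cong (λ k → δ b₁ v + (δ a₁ v + k)) (ℕₚ.+-assoc (δ a₂ v) (δ b₂ v) _)))))

    start-at : Match D b₁ (a₁ ∷ a₂ ∷ b₂ ∷ a₃ ∷ b₃ ∷ []) → Hexagonal
    start-at (d , _ , here refl , p , k , rest) = ⊥-elim (no-parallel missed₁ p (Joins-sym j₁) k)
    start-at (d , _ , there (here refl) , p , k , rest) = continue E j₁ j₂ j₃ p k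
      λ v → trans (rest v) (occurrences-remove (a₁ ∷ b₂ ∷ a₃ ∷ b₃ ∷ []) (there (here refl)) v)
    start-at (d , _ , there (there (here refl)) , p , k , rest) = continue E j₁ (Joins-sym j₂) j₃ p k
      λ v → trans (rest v) (occurrences-remove (a₁ ∷ a₂ ∷ a₃ ∷ b₃ ∷ []) (there (here refl)) v)
    start-at (d , _ , there (there (there (here refl))) , p , k , rest) =
      continue (MissedEdges-swap E) j₁ j₃ j₂ p k
      λ v → trans (rest v) (occurrences-remove (a₁ ∷ a₂ ∷ b₂ ∷ b₃ ∷ []) (there (there (there (here refl)))) v)
    start-at (d , _ , there (there (there (there (here refl)))) , p , k , rest) =
      continue (MissedEdges-swap E) j₁ (Joins-sym j₃) j₂ p k
      λ v → trans (rest v) (occurrences-remove (a₁ ∷ a₂ ∷ b₂ ∷ a₃ ∷ []) (there (there (there (here refl)))) v)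

  hexagonal : Hexagonal
  hexagonal = let e₁ , e₂ , e₃ , E = missed-edges in
    hexagonal-of E (joins-ends e₁) (joins-ends e₂) (joins-ends e₃)

  -- The initial colouring given by the three matchings, and the cover.

  module Cover (H : Hexagonal) where
    open Hexagonal H
    open Hexagon G v h v-injective h-joins

    single : Colour → Weight
    single i e = once (lookup (M i) e) (twice (lookup (M 0F) e) (lookup (M 1F) e) (lookup (M 2F) e))

    shared : Colour → Vertex → ℕ
    shared i x = m i (h 1F) * inc (h 1F) x + (m i (h 3F) * inc (h 3F) x + m i (h 5F) * inc (h 5F) x)

    degree-shared : ∀ i x → degree (λ e → m i e * D e) x ≡ shared i x
    degree-shared i x = trans (degree-cong expand x)
      (trans (degree-+ (part 1F) (λ e → part 3F e + part 5F e) x)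
        (cong₂ _+_ (degree-δ* (h 1F) (m i) x)
          (trans (degree-+ (part 3F) (part 5F) x)
            (cong₂ _+_ (degree-δ* (h 3F) (m i) x) (degree-δ* (h 5F) (m i) x)))))
      where
      part : Corner → Weight
      part k e = δ (h k) e * m i e

      expand : ∀ e → m i e * D e ≡ part 1F e + (part 3F e + part 5F e)
      expand e = trans (cong (m i e *_) (twice-h e)) (trans (ℕₚ.*-comm (m i e) _)
        (trans (ℕₚ.*-distribʳ-+ (m i e) (δ (h 1F) e) _)
          (cong (part 1F e +_) (ℕₚ.*-distribʳ-+ (m i e) (δ (h 3F) e) (δ (h 5F) e)))))

    -- `M i` splits into its edges covered only once, which form colour class `i`, and its doubly
    -- covered ones, which lie on the hexagon and are counted by `shared`.
    degree-single : ∀ i x → degree (single i) x + shared i x ≡ 1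
    degree-single i x = trans (cong (degree (single i) x +_) (sym (degree-shared i x)))
      (trans (sym (degree-+ (single i) (λ e → m i e * D e) x))
        (trans (degree-cong (λ e → sym (once-split (lookup (M i) e)
          (twice (lookup (M 0F) e) (lookup (M 1F) e) (lookup (M 2F) e)))) x) (degree-m i x)))

    inc-corner : ∀ k l → inc (h k) (v l) ≡ δ k l + δ (next k) l
    inc-corner k l = trans (incidence (h-joins k) (v l))
      (cong₂ _+_ (δ-injective v-injective k l) (δ-injective v-injective (next k) l))

    inc-away : ∀ {x} → (∀ k → v k ≢ x) → ∀ k → inc (h k) x ≡ 0
    inc-away {x} away k = trans (incidence (h-joins k) x) (cong₂ _+_ (δ-≢ (away k)) (δ-≢ (away (next k))))

    shared-at : ∀ i x {a b c} → inc (h 1F) x ≡ a → inc (h 3F) x ≡ b → inc (h 5F) x ≡ c →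
      shared i x ≡ m i (h 1F) * a + (m i (h 3F) * b + m i (h 5F) * c)
    shared-at i x refl refl refl = refl

    shared-corner : ∀ i l → shared i (v l) ≡ m i (lookup (h 5F ∷ h 1F ∷ h 1F ∷ h 3F ∷ h 3F ∷ h 5F ∷ []) l)
    shared-corner i l = trans (shared-at i (v l) (inc-corner 1F l) (inc-corner 3F l) (inc-corner 5F l)) (value l)
      where
      value : ∀ l → m i (h 1F) * (δ 1F l + δ 2F l)
          + (m i (h 3F) * (δ 3F l + δ 4F l) + m i (h 5F) * (δ 5F l + δ 0F l))
        ≡ m i (lookup (h 5F ∷ h 1F ∷ h 1F ∷ h 3F ∷ h 3F ∷ h 5F ∷ []) l)
      value 0F = combination₃ (m i (h 1F)) (m i (h 3F)) (m i (h 5F))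
      value 1F = combination₁ (m i (h 1F)) (m i (h 3F)) (m i (h 5F))
      value 2F = combination₁ (m i (h 1F)) (m i (h 3F)) (m i (h 5F))
      value 3F = combination₂ (m i (h 1F)) (m i (h 3F)) (m i (h 5F))
      value 4F = combination₂ (m i (h 1F)) (m i (h 3F)) (m i (h 5F))
      value 5F = combination₃ (m i (h 1F)) (m i (h 3F)) (m i (h 5F))

    -- The colour absent from a doubly covered edge is that of the edges leaving
    -- the hexagon at both its ends.
    absent : ∀ d → 1 ≤ D d → ∃[ c ] (∀ i → δ c i + m i d ≡ 1)
    absent d p = absent-colour (λ i → lookup (M i) d) p (no-triple d)

    D-h : ∀ {k} → 1 ≤ δ (h 1F) (h k) + (δ (h 3F) (h k) + δ (h 5F) (h k)) → 1 ≤ D (h k)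
    D-h {k} = subst (1 ≤_) (sym (twice-h (h k)))

    absent₁ = absent (h 1F) (D-h (ℕₚ.≤-trans (ℕₚ.≤-reflexive (sym (δ-refl (h 1F)))) (ℕₚ.m≤m+n _ _)))
    absent₃ = absent (h 3F) (D-h (ℕₚ.≤-trans (ℕₚ.≤-reflexive (sym (δ-refl (h 3F))))
      (ℕₚ.≤-trans (ℕₚ.m≤m+n _ (δ (h 5F) (h 3F))) (ℕₚ.m≤n+m _ (δ (h 1F) (h 3F))))))
    absent₅ = absent (h 5F) (D-h (ℕₚ.≤-trans (ℕₚ.≤-reflexive (sym (δ-refl (h 5F))))
      (ℕₚ.≤-trans (ℕₚ.m≤n+m _ (δ (h 3F) (h 5F))) (ℕₚ.m≤n+m _ (δ (h 1F) (h 5F))))))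

    initial : Colouring
    initial = start (proj₁ absent₁) (proj₁ absent₃) (proj₁ absent₅)

    initial-corner : ∀ i l → degree (single i) (v l) ≡ δ (initial l) i
    -- Both sides reach 1 when the membership in `M i` of the doubly covered edge at corner `l` is
    -- added, so that common term cancels.
    initial-corner i l = ℕₚ.+-cancelʳ-≡ _ _ _
      (trans (trans (cong (degree (single i) (v l) +_) (sym (shared-corner i l)))
        (degree-single i (v l))) (sym (balanced l)))
      where
      balanced : ∀ l → δ (initial l) i + m i (lookup (h 5F ∷ h 1F ∷ h 1F ∷ h 3F ∷ h 3F ∷ h 5F ∷ []) l) ≡ 1
      balanced 0F = proj₂ absent₅ i
      balanced 1F = proj₂ absent₁ i
      balanced 2F = proj₂ absent₁ i
      balanced 3F = proj₂ absent₃ i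
      balanced 4F = proj₂ absent₃ i
      balanced 5F = proj₂ absent₅ i

    initial-off : ∀ i {x} → (∀ k → v k ≢ x) → degree (single i) x ≡ 1
    initial-off i {x} away = trans (sym (ℕₚ.+-identityʳ _))
      (trans (cong (degree (single i) x +_) (sym none-shared)) (degree-single i x))
      where
      none-shared : shared i x ≡ 0
      none-shared = trans (shared-at i x (inc-away away 1F) (inc-away away 3F) (inc-away away 5F))
        (cong₂ _+_ (ℕₚ.*-zeroʳ (m i (h 1F))) (cong₂ _+_ (ℕₚ.*-zeroʳ (m i (h 3F))) (ℕₚ.*-zeroʳ (m i (h 5F)))))

    initial-cover : ∀ e → (∃[ k ] h k ≡ e) ⊎ (∃[ i ] 1 ≤ single i e)
    initial-cover e = case positive-+ (Z e) (coverage (lookup (M 0F) e) (lookup (M 1F) e) (lookup (M 2F) e)) of λ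
      { (inj₁ p) → inj₁ (case missed-h e p of λ
          { (inj₁ q) → 0F , q ; (inj₂ (inj₁ q)) → 2F , q ; (inj₂ (inj₂ q)) → 4F , q })
      ; (inj₂ p) → case positive-+ (D e) p of λ
        { (inj₁ q) → inj₁ (case one-of-three (subst (1 ≤_) (twice-h e) q) of λ
            { (inj₁ r) → 1F , r ; (inj₂ (inj₁ r)) → 3F , r ; (inj₂ (inj₂ r)) → 5F , r })
        ; (inj₂ q) → inj₂ ([ (0F ,_) , [ (1F ,_) , (2F ,_) ]′ ∘ positive-+ (single 1F e) ]′
            (positive-+ (single 0F e) q)) } }

    initial-realised : Realises initial
    initial-realised = record
      { class = single ; corner = initial-corner ; off = initial-off ; cover = initial-cover }

    covered : ∀ e → Any (e ∈_) (M 0F ∷ M 1F ∷ M 2F ∷ []) ⊎ (h 0F ≡ e ⊎ h 2F ≡ e ⊎ h 4F ≡ e)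
    covered e = case positive-+ (m 0F e) (subst (1 ≤_)
        (sym (balance (lookup (M 0F) e) (lookup (M 1F) e) (lookup (M 2F) e))) (s≤s z≤n)) of λ
      { (inj₁ p) → inj₁ (here (indicator-positive p))
      ; (inj₂ p) → case positive-+ (m 1F e) p of λ
        { (inj₁ q) → inj₁ (there (here (indicator-positive q)))
        ; (inj₂ q) → [ inj₁ ∘ there ∘ there ∘ here ∘ indicator-positive , inj₂ ∘ missed-h e ]′
            (positive-+ (m 2F e) q) } }

    bergeCover : ∃[ Ms ] BergeCover G Ms
    bergeCover = bergeCover-of-win (perfect 0F) (perfect 1F) (perfect 2F) covered
      plan {start a b c} (start-wins a b c) initial-realised
      where
      a b c : Colour
      a = proj₁ absent₁
      b = proj₁ absent₃
      c = proj₁ absent₅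

theorem1p1 : (G : Multigraph) → Cubic G → Bridgeless G →
    ColouringDefect G 3 → ∃[ Ms ] BergeCover G Ms
theorem1p1 G cubic bridgeless ((M₁ , M₂ , M₃ , perfect₁ , perfect₂ , perfect₃ , three) , minimal) =
  Cover.bergeCover hexagonal
  where
  M : Fin 3 → Multigraph.EdgeSet G
  M = lookup (M₁ ∷ M₂ ∷ M₃ ∷ [])

  perfect : ∀ i → PerfectMatching G (M i)
  perfect 0F = perfect₁
  perfect 1F = perfect₂
  perfect 2F = perfect₃

  open Defect G cubic bridgeless M perfect three minimal
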